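{- Let $k$ be an odd integer with $k\ge 3$, and let $G$ be a finite simple $k$-regular graph (not assumed to be connected). Then $G$ is antimagic; that is, writing $m=|E(G)|$, there exists a bijection $f:E(G)\to\{1,2,\ldots,m\}$ such that for all distinct vertices $u,v\in V(G)$, $$\sum_{e\in E(u)}f(e)\neq\sum_{e\in E(v)}f(e),$$ where $E(x)$ denotes the set of edges of $G$ incident to the vertex $x$.
   Context: Graphs are finite, undirected and simple (no loops, no parallel edges). A labeling of a graph $G$ with $m$ edges is a bijection from $E(G)$ to $\{1,2,\ldots,m\}$. Given a labeling, the vertex sum at a vertex $v$ is the sum of the labels on the edges incident to $v$. A labeling is antimagic if all its vertex sums are pairwise different, and a graph is antimagic if it has an antimagic labeling. -}

module Defs where

open import Level using (0ℓ)
open import Data.Nat.Base using (ℕ; suc)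
open import Data.Fin.Base using (Fin; toℕ; _<_)
open import Data.Fin.Properties using (_≟_; _<?_)
open import Data.List.Base
  using (List; []; _∷_; allFin; cartesianProduct; filter; length; map; mapMaybe; sum)
open import Data.List.Membership.Propositional using (_∈_)
open import Data.List.Membership.Propositional.Properties
  using (∈-allFin; ∈-cartesianProduct⁺)
open import Data.List.Relation.Unary.All as All using (All; []; _∷_)
open import Data.List.Relation.Unary.Any using (here; there)
open import Data.List.Relation.Unary.AllPairs using ([]; _∷_)
open import Data.List.Relation.Unary.Unique.Propositional using (Unique)
open import Data.List.Relation.Unary.Unique.Propositional.Properties
  using (allFin⁺; cartesianProduct⁺)
open import Data.Maybe.Base using (Maybe; just; nothing)
open import Data.Product.Base using (∃; _×_; _,_)
open import Data.Sum.Base using (_⊎_)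
open import Function.Bundles using (_⤖_; module Bijection)
open import Relation.Binary.Core using (Rel)
open import Relation.Binary.Definitions using (Decidable; Irreflexive; Symmetric)
open import Relation.Binary.PropositionalEquality using (_≡_; _≢_; refl; sym; trans; cong)
open import Relation.Nullary.Decidable using (yes; no; _×-dec_; _⊎-dec_)
open import Relation.Nullary.Negation using (contradiction-irr)
import Relation.Unary as Unary

record Graph (n : ℕ) : Set₁ where
  infix 4 _~_ _~?_
  field
    _~_      : Rel (Fin n) 0ℓ
    ~-sym    : Symmetric _~_
    ~-irrefl : Irreflexive _≡_ _~_
    _~?_     : Decidable _~_

module _ {n : ℕ} (G : Graph n) where

  open Graph G

  -- The unordered pair {u, v} is stored with its smaller endpoint first, and
  -- the proofs are irrelevant, so there is exactly one Edge for each
  -- unordered pair of adjacent vertices.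
  record Edge : Set where
    constructor edge
    field
      low high  : Fin n
      .low<high : low < high
      .low~high : low ~ high

  Incident : Fin n → Edge → Set
  Incident v e = v ≡ Edge.low e ⊎ v ≡ Edge.high e

  incident? : (v : Fin n) → Unary.Decidable (Incident v)
  incident? v e = (v ≟ Edge.low e) ⊎-dec (v ≟ Edge.high e)

  toEdge : Fin n × Fin n → Maybe Edge
  toEdge (u , v) with (u <? v) ×-dec (u ~? v)
  ... | yes (u<v , u~v) = just (edge u v u<v u~v)
  ... | no _            = nothing

  -- Lists every edge exactly once: see ∈-edges and edges-unique.
  edges : List Edge
  edges = mapMaybe toEdge (cartesianProduct (allFin n) (allFin n))

  edgeCount : ℕ
  edgeCount = length edges

  incidentEdges : Fin n → List Edge
  incidentEdges v = filter (incident? v) edges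

  degree : Fin n → ℕ
  degree v = length (incidentEdges v)

  Regular : ℕ → Set
  Regular k = ∀ v → degree v ≡ k

  -- Fin m stands for {1, …, m}: the element i stands for the label i + 1.
  Labeling : Set
  Labeling = Edge ⤖ Fin edgeCount

  label : Labeling → Edge → ℕ
  label f e = suc (toℕ (Bijection.to f e))

  vertexSum : Labeling → Fin n → ℕ
  vertexSum f v = sum (map (label f) (incidentEdges v))

  IsAntimagic : Labeling → Set
  IsAntimagic f = ∀ {u v} → u ≢ v → vertexSum f u ≢ vertexSum f v

  Antimagic : Set
  Antimagic = ∃ IsAntimagic

  private

    endpoints : Edge → Fin n × Fin n
    endpoints (edge u v _ _) = u , v

    toEdge-endpoints : ∀ e → toEdge (endpoints e) ≡ just e
    toEdge-endpoints (edge u v u<v u~v) with (u <? v) ×-dec (u ~? v)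
    ... | yes _ = refl
    ... | no ¬p = contradiction-irr (u<v , u~v) ¬p

    endpoints-toEdge : ∀ p {e} → toEdge p ≡ just e → p ≡ endpoints e
    endpoints-toEdge (u , v) eq with (u <? v) ×-dec (u ~? v)
    endpoints-toEdge (u , v) refl | yes _ = refl

    ∈-mapMaybe : ∀ {e p} {ps : List (Fin n × Fin n)} → toEdge p ≡ just e →
                 p ∈ ps → e ∈ mapMaybe toEdge ps
    ∈-mapMaybe {p = p} eq (here refl) with toEdge p | eq
    ... | just _ | refl = here refl
    ∈-mapMaybe {ps = q ∷ _} eq (there p∈ps) with toEdge q
    ... | just _  = there (∈-mapMaybe eq p∈ps)
    ... | nothing = ∈-mapMaybe eq p∈ps

    all-mapMaybe : ∀ {p e} {ps : List (Fin n × Fin n)} → p ≡ endpoints e →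
                   All (p ≢_) ps → All (e ≢_) (mapMaybe toEdge ps)
    all-mapMaybe eq [] = []
    all-mapMaybe {ps = q ∷ _} eq (p≢q ∷ p≢ps) with toEdge q in eq′
    ... | nothing = all-mapMaybe eq p≢ps
    ... | just e′ =
      (λ e≡e′ → p≢q (trans eq (trans (cong endpoints e≡e′) (sym (endpoints-toEdge q eq′)))))
      ∷ all-mapMaybe eq p≢ps

    unique-mapMaybe : {ps : List (Fin n × Fin n)} → Unique ps → Unique (mapMaybe toEdge ps)
    unique-mapMaybe [] = []
    unique-mapMaybe {p ∷ _} (p≢ps ∷ u) with toEdge p in eq
    ... | nothing = unique-mapMaybe u
    ... | just _  = all-mapMaybe (endpoints-toEdge p eq) p≢ps ∷ unique-mapMaybe u

  ∈-edges : ∀ e → e ∈ edges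
  ∈-edges e = ∈-mapMaybe (toEdge-endpoints e)
    (∈-cartesianProduct⁺ (∈-allFin (Edge.low e)) (∈-allFin (Edge.high e)))

  edges-unique : Unique edges
  edges-unique = unique-mapMaybe (cartesianProduct⁺ (allFin⁺ n) (allFin⁺ n))

{-# OPTIONS --safe #-}
-- Rank the vertices so that the ranks of adjacent vertices differ by at most one and every vertex
-- has a neighbour of rank one less (breadth-first search), except for vertices alone in their rank
-- (the roots of the components).  The labels are given out in increasing order, from the highest
-- rank l downwards: first to the edges inside layer l, then to the edges from layer l to layer
-- l − 1, of which each vertex t of layer l keeps back one, σ(t), and finally to the edges σ(t).
--
-- Write k = 2K + 1.  The edges between the two layers other than the σ(t) are decomposed into open
-- trails with distinct ends in the lower layer.  This is possible since for edges x, y, z, where y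
-- and z have different lower ends, the pair x, y or the pair x, z can be added to the trails
-- without closing one; only the last edge at t is kept back.  Labelling the trails a, b, a + 1,
-- b − 1, … gives consecutive edges the sum c = a + b at layer l and c + 1 at layer l − 1.  As
-- k − 1 is even, the edges at a vertex of layer l other than σ(t) have sum at most K c, and those
-- at a vertex of layer l − 1, with its largest label left out, have sum more than K c.  This
-- separates the layers.  Inside layer l, giving the labels of the edges σ(t) in the order of the
-- sums of the other labels at t makes the vertex sums different.
module Submission where

open import Data.Empty using (⊥)
open import Data.Fin.Base using (Fin; zero; suc; toℕ; cast) renaming (_<_ to _<ᶠ_)
import Data.Fin.Properties as Fin
open import Data.List.Base
  using (List; []; _∷_; [_]; _++_; map; length; filter; allFin; fromMaybe; lookup)
open import Data.List.Membership.Propositional using (_∈_)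
open import Data.List.Membership.Propositional.Properties using (∈-allFin; ∈-lookup; ∈-filter⁺)
open import Data.List.Properties using (map-++; map-cong; ++-assoc; length-++)
open import Data.List.Relation.Binary.Permutation.Propositional using (_↭_; ↭-sym)
open import Data.List.Relation.Binary.Permutation.Propositional.Properties using (map⁺; All-resp-↭)
open import Data.List.Relation.Unary.All as All using (All; []; _∷_)
open import Data.List.Relation.Unary.All.Properties using (all-filter)
open import Data.List.Relation.Unary.AllPairs using (AllPairs; []; _∷_)
open import Data.List.Relation.Unary.Any using (here; there; index)
open import Data.List.Relation.Unary.Any.Properties using (lookup-index)
open import Data.List.Relation.Unary.Sorted.TotalOrder.Properties using (Sorted⇒AllPairs)
open import Data.List.Relation.Unary.Unique.Propositional using (Unique)
open import Data.List.Relation.Unary.Unique.Propositional.Properties using (allFin⁺)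
  renaming (filter⁺ to unique-filter⁺)
import Data.List.Sort
open import Data.Maybe.Base using (Maybe; just; nothing)
open import Data.Nat.Base
open import Data.Nat.ListAction using (sum)
open import Data.Nat.ListAction.Properties using (sum-++; sum-↭)
open import Data.Nat.Properties
open import Data.Nat.Tactic.RingSolver using (solve-∀)
open import Data.Parity.Base using (1ℙ)
open import Data.Product.Base using (∃; _×_; _,_; proj₁; proj₂)
open import Data.Sum.Base using (_⊎_; inj₁; inj₂)
open import Function.Base using (_∘_)
open import Function.Bundles using (mk↔ₛ′)
open import Function.Properties.Inverse using (↔⇒⤖)
open import Level using (0ℓ)
open import Relation.Binary.Bundles using (DecTotalOrder)
import Relation.Binary.Construct.On as On
open import Relation.Binary.Definitions using (tri<; tri≈; tri>; DecidableEquality)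
open import Relation.Binary.PropositionalEquality
  using (_≡_; _≢_; refl; sym; trans; cong; cong₂; subst; subst₂; module ≡-Reasoning)
open import Relation.Nullary.Decidable
  using (Dec; yes; no; ¬?; _×-dec_; decidable-stable; recompute)
open import Relation.Nullary.Negation using (¬_; contradiction)
open import Relation.Unary as Unary using (Pred)
open import Defs

private variable
  A B : Set

-- Sums over lists

-- That one list rearranges others is expressed below by an equality of `∑ g` for all `g`; indicator
-- functions as `g` then recover multiplicities.
∑ : (A → ℕ) → List A → ℕ
∑ g xs = sum (map g xs)

∑-++ : (g : A → ℕ) → ∀ xs ys → ∑ g (xs ++ ys) ≡ ∑ g xs + ∑ g ys
∑-++ g xs ys = trans (cong sum (map-++ g xs ys)) (sum-++ (map g xs) (map g ys))

∑-cong : {g h : A → ℕ} → (∀ x → g x ≡ h x) → ∀ xs → ∑ g xs ≡ ∑ h xs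
∑-cong g≗h xs = cong sum (map-cong g≗h xs)

∑-cong-All : {g h : A → ℕ} {xs : List A} → All (λ x → g x ≡ h x) xs → ∑ g xs ≡ ∑ h xs
∑-cong-All []       = refl
∑-cong-All (p ∷ ps) = cong₂ _+_ p (∑-cong-All ps)

∑-zero : (xs : List A) → ∑ (λ _ → 0) xs ≡ 0
∑-zero []       = refl
∑-zero (_ ∷ xs) = ∑-zero xs

∑-+ : (g h : A → ℕ) → ∀ xs → ∑ (λ x → g x + h x) xs ≡ ∑ g xs + ∑ h xs
∑-+ g h []       = refl
∑-+ g h (x ∷ xs) = trans (cong (g x + h x +_) (∑-+ g h xs)) (eq (g x) (h x) _ _)
  where
  eq : ∀ a b c d → a + b + (c + d) ≡ a + c + (b + d)
  eq = solve-∀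

∑-*ʳ : (g : A → ℕ) → ∀ c xs → ∑ (λ x → g x * c) xs ≡ ∑ g xs * c
∑-*ʳ g c []       = refl
∑-*ʳ g c (x ∷ xs) = trans (cong (g x * c +_) (∑-*ʳ g c xs)) (sym (*-distribʳ-+ c (g x) _))

∑-swap : (g : A → B → ℕ) → ∀ xs ys → ∑ (λ x → ∑ (g x) ys) xs ≡ ∑ (λ y → ∑ (λ x → g x y) xs) ys
∑-swap g []       ys = sym (∑-zero ys)
∑-swap g (x ∷ xs) ys =
  trans (cong (∑ (g x) ys +_) (∑-swap g xs ys)) (sym (∑-+ (g x) (λ y → ∑ (λ x → g x y) xs) ys))

∑-mono : {g h : A → ℕ} → (∀ x → g x ≤ h x) → ∀ xs → ∑ g xs ≤ ∑ h xs
∑-mono g≤h []       = z≤n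
∑-mono g≤h (x ∷ xs) = +-mono-≤ (g≤h x) (∑-mono g≤h xs)

∑-1 : (xs : List A) → ∑ (λ _ → 1) xs ≡ length xs
∑-1 []       = refl
∑-1 (_ ∷ xs) = cong suc (∑-1 xs)

∑-∈ : (g : A → ℕ) {x : A} {xs : List A} → x ∈ xs → g x ≤ ∑ g xs
∑-∈ g (here refl)  = m≤m+n _ _
∑-∈ g (there x∈xs) = ≤-trans (∑-∈ g x∈xs) (m≤n+m _ _)

∑-positive : (g : A → ℕ) → ∀ xs → 0 < ∑ g xs → ∃ λ x → x ∈ xs × 0 < g x
∑-positive g (x ∷ xs) pos with g x in eq
... | suc _ = x , here refl , subst (0 <_) (sym eq) z<s
... | zero  = let y , y∈xs , p = ∑-positive g xs pos in y , there y∈xs , p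

𝟙 : {P : Set} → Dec P → ℕ
𝟙 (yes _) = 1
𝟙 (no _)  = 0

𝟙-yes : {P : Set} (P? : Dec P) → P → 𝟙 P? ≡ 1
𝟙-yes (yes _) p = refl
𝟙-yes (no ¬p) p = contradiction p ¬p

𝟙-no : {P : Set} (P? : Dec P) → ¬ P → 𝟙 P? ≡ 0
𝟙-no (yes p) ¬p = contradiction p ¬p
𝟙-no (no _)  ¬p = refl

𝟙-cong : {P Q : Set} (P? : Dec P) (Q? : Dec Q) → (P → Q) → (Q → P) → 𝟙 P? ≡ 𝟙 Q?
𝟙-cong (yes p) Q? to from = sym (𝟙-yes Q? (to p))
𝟙-cong (no ¬p) Q? to from = sym (𝟙-no Q? (¬p ∘ from))

𝟙≤1 : {P : Set} (P? : Dec P) → 𝟙 P? ≤ 1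
𝟙≤1 (yes _) = s≤s z≤n
𝟙≤1 (no _)  = z≤n

𝟙-positive : {P : Set} (P? : Dec P) → 0 < 𝟙 P? → P
𝟙-positive (yes p) _ = p

∑-filter : {P : Pred A 0ℓ} (P? : Unary.Decidable P) (g : A → ℕ) → ∀ xs →
           ∑ g (filter P? xs) ≡ ∑ (λ x → 𝟙 (P? x) * g x) xs
∑-filter P? g [] = refl
∑-filter P? g (x ∷ xs) with P? x
... | yes _ = cong₂ _+_ (sym (+-identityʳ (g x))) (∑-filter P? g xs)
... | no _  = ∑-filter P? g xs

∑≡0⇒All : (g : A → ℕ) → ∀ xs → ∑ g xs ≡ 0 → All (λ x → g x ≡ 0) xs
∑≡0⇒All g []       _  = []
∑≡0⇒All g (x ∷ xs) eq = m+n≡0⇒m≡0 (g x) eq ∷ ∑≡0⇒All g xs (m+n≡0⇒n≡0 (g x) eq)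

δ : ∀ {n} → Fin n → Fin n → ℕ
δ u v = 𝟙 (u Fin.≟ v)

δ-refl : ∀ {n} (v : Fin n) → δ v v ≡ 1
δ-refl v = 𝟙-yes (v Fin.≟ v) refl

δ-≢ : ∀ {n} {u v : Fin n} → u ≢ v → δ u v ≡ 0
δ-≢ {u = u} {v} = 𝟙-no (u Fin.≟ v)

-- Sums weighted by position

-- If the label of an edge is its position in a list, counted from `a = 1`, and `h` counts
-- incidences with a vertex, this is the vertex sum.
weighted : (A → ℕ) → ℕ → List A → ℕ
weighted h a []       = 0
weighted h a (x ∷ xs) = a * h x + weighted h (suc a) xs

weighted-++ : (h : A → ℕ) → ∀ a xs ys →
              weighted h a (xs ++ ys) ≡ weighted h a xs + weighted h (a + length xs) ys
weighted-++ h a []       ys = cong (λ b → weighted h b ys) (sym (+-identityʳ a))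
weighted-++ h a (x ∷ xs) ys = begin
  a * h x + weighted h (suc a) (xs ++ ys)
    ≡⟨ cong (a * h x +_) (weighted-++ h (suc a) xs ys) ⟩
  a * h x + (weighted h (suc a) xs + weighted h (suc (a + length xs)) ys)
    ≡⟨ sym (+-assoc (a * h x) _ _) ⟩
  weighted h a (x ∷ xs) + weighted h (suc (a + length xs)) ys
    ≡⟨ cong (λ b → weighted h a (x ∷ xs) + weighted h b ys) (sym (+-suc a _)) ⟩
  weighted h a (x ∷ xs) + weighted h (a + length (x ∷ xs)) ys ∎
  where open ≡-Reasoning

weighted-≥ : (h : A → ℕ) → ∀ a xs → a * ∑ h xs ≤ weighted h a xs
weighted-≥ h a []       = ≤-reflexive (*-zeroʳ a)
weighted-≥ h a (x ∷ xs) = begin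
  a * (h x + ∑ h xs)              ≡⟨ *-distribˡ-+ a (h x) _ ⟩
  a * h x + a * ∑ h xs            ≤⟨ +-monoʳ-≤ (a * h x) (*-monoˡ-≤ (∑ h xs) (n≤1+n a)) ⟩
  a * h x + suc a * ∑ h xs        ≤⟨ +-monoʳ-≤ (a * h x) (weighted-≥ h (suc a) xs) ⟩
  a * h x + weighted h (suc a) xs ∎
  where open ≤-Reasoning

weighted-≤ : (h : A → ℕ) → ∀ a xs → weighted h (suc a) xs ≤ (a + length xs) * ∑ h xs
weighted-≤ h a []       = z≤n
weighted-≤ h a (x ∷ xs) = begin
  suc a * h x + weighted h (suc (suc a)) xs
    ≤⟨ +-mono-≤ (*-monoˡ-≤ (h x) (s≤s (m≤m+n a (length xs)))) (weighted-≤ h (suc a) xs) ⟩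
  suc (a + length xs) * h x + suc (a + length xs) * ∑ h xs
    ≡⟨ sym (*-distribˡ-+ (suc (a + length xs)) (h x) _) ⟩
  suc (a + length xs) * (h x + ∑ h xs)
    ≡⟨ cong (_* (h x + ∑ h xs)) (sym (+-suc a _)) ⟩
  (a + length (x ∷ xs)) * (h x + ∑ h xs) ∎
  where open ≤-Reasoning

weighted-∑≡0 : (h : A → ℕ) → ∀ a xs → ∑ h xs ≡ 0 → weighted h (suc a) xs ≡ 0
weighted-∑≡0 h a xs eq = n≤0⇒n≡0 (≤-trans (weighted-≤ h a xs)
  (≤-reflexive (trans (cong ((a + length xs) *_) eq) (*-zeroʳ (a + length xs)))))

-- The bound counts the last element of xs with its position, a + length xs.
weighted-≥-last : (h : A → ℕ) → ∀ a xs → All (λ x → 1 ≤ h x) xs →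
                  suc a * ∑ h xs + length xs ≤ suc (weighted h (suc a) xs)
weighted-≥-last h a [] [] = ≤-trans (≤-reflexive (cong (_+ 0) (*-zeroʳ a))) z≤n
weighted-≥-last h a (x ∷ []) (p ∷ []) = ≤-reflexive (eq a (h x))
  where
  eq : ∀ a b → suc a * (b + 0) + 1 ≡ suc (suc a * b + 0)
  eq = solve-∀
weighted-≥-last h a (x ∷ xs@(y ∷ _)) (_ ∷ ps@(p ∷ _)) = begin
  suc a * (h x + S) + suc ℓ            ≡⟨ eq₁ a (h x) S ℓ ⟩
  suc a * h x + (suc a * S + 1 + ℓ)    ≤⟨ +-monoʳ-≤ (suc a * h x)
                                            (+-monoˡ-≤ ℓ (+-monoʳ-≤ (suc a * S) 1≤S)) ⟩
  suc a * h x + (suc a * S + S + ℓ)    ≡⟨ eq₂ a (h x) S ℓ ⟩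
  suc a * h x + (suc (suc a) * S + ℓ)  ≤⟨ +-monoʳ-≤ (suc a * h x) (weighted-≥-last h (suc a) xs ps) ⟩
  suc a * h x + suc (weighted h (suc (suc a)) xs) ≡⟨ +-suc (suc a * h x) _ ⟩
  suc (weighted h (suc a) (x ∷ xs))    ∎
  where
  open ≤-Reasoning
  S ℓ : ℕ
  S = ∑ h xs
  ℓ = length xs
  1≤S : 1 ≤ S
  1≤S = ≤-trans p (m≤m+n _ _)
  eq₁ : ∀ a b s l → suc a * (b + s) + suc l ≡ suc a * b + (suc a * s + 1 + l)
  eq₁ = solve-∀
  eq₂ : ∀ a b s l → suc a * b + (suc a * s + s + l) ≡ suc a * b + (suc (suc a) * s + l)
  eq₂ = solve-∀

-- Zigzag order: with the positions a, …, b, the elements of a list are placed at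
-- a, b, a + 1, b − 1, … (zig) or at b, a, b − 1, a + 1, … (zag).

zig zag : List A → List A
zig []       = []
zig (x ∷ xs) = x ∷ zag xs
zag []       = []
zag (x ∷ xs) = zig xs ++ [ x ]

∑-zig : (g : A → ℕ) → ∀ xs → ∑ g (zig xs) ≡ ∑ g xs
∑-zag : (g : A → ℕ) → ∀ xs → ∑ g (zag xs) ≡ ∑ g xs
∑-zig g []       = refl
∑-zig g (x ∷ xs) = cong (g x +_) (∑-zag g xs)
∑-zag g []       = refl
∑-zag g (x ∷ xs) = begin
  ∑ g (zig xs ++ [ x ])   ≡⟨ ∑-++ g (zig xs) [ x ] ⟩
  ∑ g (zig xs) + (g x + 0) ≡⟨ cong₂ _+_ (∑-zig g xs) (+-identityʳ (g x)) ⟩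
  ∑ g xs + g x            ≡⟨ +-comm _ (g x) ⟩
  g x + ∑ g xs            ∎
  where open ≡-Reasoning

length-zig : (xs : List A) → length (zig xs) ≡ length xs
length-zig xs = trans (sym (∑-1 (zig xs))) (trans (∑-zig (λ _ → 1) xs) (∑-1 xs))

length-zag : (xs : List A) → length (zag xs) ≡ length xs
length-zag xs = trans (sym (∑-1 (zag xs))) (trans (∑-zag (λ _ → 1) xs) (∑-1 xs))

-- With the list cut into the consecutive pairs (x₁, x₂), (x₃, x₄), …, solo sums
-- ∣ h x − h y ∣ over the pairs; soloFrom c shifts the cut by one and
-- completes x₁ to a pair with an element of value c.
solo     : (A → ℕ) → List A → ℕ
soloFrom : (A → ℕ) → ℕ → List A → ℕ
solo h []             = 0
solo h (x ∷ xs)       = soloFrom h (h x) xs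
soloFrom h c []       = c
soloFrom h c (x ∷ xs) = ∣ c - h x ∣ + solo h xs

-- Parity of the solo sums.

Even : ℕ → Set
Even m = ∃ λ j → m ≡ j + j

dist-parity : ∀ a b → Even (∣ a - b ∣ + (a + b))
dist-parity zero    b       = b , refl
dist-parity (suc a) zero    = suc a , cong (suc a +_) (+-identityʳ (suc a))
dist-parity (suc a) (suc b) =
  let j , eq = dist-parity a b in suc j , trans (eq₁ ∣ a - b ∣ a b) (trans (cong (2 +_) eq) (eq₂ j))
  where
  eq₁ : ∀ d a b → d + (suc a + suc b) ≡ 2 + (d + (a + b))
  eq₁ = solve-∀
  eq₂ : ∀ j → 2 + (j + j) ≡ suc j + suc j
  eq₂ = solve-∀

-- The difference and the sum of the two values of a pair have the same parity.
solo-parity     : (h : A → ℕ) → ∀ xs → Even (solo h xs + ∑ h xs)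
soloFrom-parity : (h : A → ℕ) → ∀ c xs → Even (soloFrom h c xs + (c + ∑ h xs))
solo-parity h []       = 0 , refl
solo-parity h (x ∷ xs) = soloFrom-parity h (h x) xs
soloFrom-parity h c []       = c , cong (c +_) (+-identityʳ c)
soloFrom-parity h c (x ∷ xs) =
  let i , p = dist-parity c (h x)
      j , q = solo-parity h xs
  in i + j , trans (eq₁ ∣ c - h x ∣ (solo h xs) c (h x) (∑ h xs)) (trans (cong₂ _+_ p q) (eq₂ i j))
  where
  eq₁ : ∀ d s c x t → d + s + (c + (x + t)) ≡ (d + (c + x)) + (s + t)
  eq₁ = solve-∀
  eq₂ : ∀ i j → (i + i) + (j + j) ≡ (i + j) + (i + j)
  eq₂ = solve-∀

solo-cong : {h k : A → ℕ} {xs : List A} → All (λ x → h x ≡ k x) xs → solo h xs ≡ solo k xs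
soloFrom-cong : {h k : A → ℕ} {xs : List A} → ∀ c → All (λ x → h x ≡ k x) xs →
                soloFrom h c xs ≡ soloFrom k c xs
solo-cong []       = refl
solo-cong {k = k} {xs = _ ∷ xs} (p ∷ ps) rewrite p = soloFrom-cong (k _) ps
soloFrom-cong c []       = refl
soloFrom-cong c (p ∷ ps) = cong₂ _+_ (cong ∣ c -_∣ p) (solo-cong ps)

-- The first pair takes the two outermost positions. Their sum is the same as for the next pair, so
-- the bounds below go by induction on pairs.
weighted-zigzag : (h : A → ℕ) → ∀ a x y xs →
  weighted h a (zig (x ∷ y ∷ xs)) ≡
  a * h x + weighted h (suc a) (zig xs) + (suc a + length xs) * h y
weighted-zigzag h a x y xs = trans (cong (a * h x +_) step) (sym (+-assoc (a * h x) _ _))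
  where
  step : weighted h (suc a) (zig xs ++ [ y ]) ≡
         weighted h (suc a) (zig xs) + (suc a + length xs) * h y
  step = trans (weighted-++ h (suc a) (zig xs) [ y ])
    (cong (weighted h (suc a) (zig xs) +_)
      (trans (+-identityʳ _) (cong (λ ℓ → (suc a + ℓ) * h y) (length-zig xs))))

weighted-zagzig : (h : A → ℕ) → ∀ a x y xs →
  weighted h a (zag (x ∷ y ∷ xs)) ≡
  a * h y + weighted h (suc a) (zag xs) + (suc a + length xs) * h x
weighted-zagzig h a x y xs = begin
  weighted h a ((y ∷ zag xs) ++ [ x ])
    ≡⟨ weighted-++ h a (y ∷ zag xs) [ x ] ⟩
  a * h y + weighted h (suc a) (zag xs) + ((a + suc (length (zag xs))) * h x + 0)
    ≡⟨ cong (a * h y + weighted h (suc a) (zag xs) +_) (+-identityʳ _) ⟩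
  a * h y + weighted h (suc a) (zag xs) + (a + suc (length (zag xs))) * h x
    ≡⟨ cong (λ b → a * h y + weighted h (suc a) (zag xs) + b * h x)
         (trans (+-suc a _) (cong (suc a +_) (length-zag xs))) ⟩
  a * h y + weighted h (suc a) (zag xs) + (suc a + length xs) * h x ∎
  where open ≡-Reasoning

-- For p = q both sides of the two bounds are equal; replacing one of the
-- labels a and a + m of a pair by the average costs at most m / 2.
pair-≤ : ∀ a m p q → 2 * (a * p + (a + m) * q) ≤ (p + q) * (a + a + m) + ∣ p - q ∣ * m
pair-≤ a m p q = begin
  2 * (a * p + (a + m) * q)             ≡⟨ eq₁ a m p q ⟩
  (p + q) * (a + a) + q * m + q * m     ≤⟨ +-monoʳ-≤ ((p + q) * (a + a) + q * m) (*-monoˡ-≤ m q≤) ⟩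
  (p + q) * (a + a) + q * m + (p + ∣ p - q ∣) * m ≡⟨ eq₂ a m p q ∣ p - q ∣ ⟩
  (p + q) * (a + a + m) + ∣ p - q ∣ * m ∎
  where
  open ≤-Reasoning
  q≤ : q ≤ p + ∣ p - q ∣
  q≤ = subst (λ d → q ≤ p + d) (∣-∣-comm q p) (m≤n+∣m-n∣ q p)
  eq₁ : ∀ a m p q → 2 * (a * p + (a + m) * q) ≡ (p + q) * (a + a) + q * m + q * m
  eq₁ = solve-∀
  eq₂ : ∀ a m p q d → (p + q) * (a + a) + q * m + (p + d) * m ≡ (p + q) * (a + a + m) + d * m
  eq₂ = solve-∀

pair-≥ : ∀ a m p q → (p + q) * (a + a + m) ≤ 2 * (a * q + (a + m) * p) + ∣ p - q ∣ * m
pair-≥ a m p q = begin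
  (p + q) * (a + a + m)                           ≡⟨ eq₁ a m p q ⟩
  (p + q) * (a + a) + p * m + q * m               ≤⟨ +-monoʳ-≤ ((p + q) * (a + a) + p * m) (*-monoˡ-≤ m q≤) ⟩
  (p + q) * (a + a) + p * m + (p + ∣ p - q ∣) * m ≡⟨ eq₂ a m p q ∣ p - q ∣ ⟩
  2 * (a * q + (a + m) * p) + ∣ p - q ∣ * m       ∎
  where
  open ≤-Reasoning
  q≤ : q ≤ p + ∣ p - q ∣
  q≤ = subst (λ d → q ≤ p + d) (∣-∣-comm q p) (m≤n+∣m-n∣ q p)
  eq₁ : ∀ a m p q → (p + q) * (a + a + m) ≡ (p + q) * (a + a) + p * m + q * m
  eq₁ = solve-∀
  eq₂ : ∀ a m p q d → (p + q) * (a + a) + p * m + (p + d) * m ≡ 2 * (a * q + (a + m) * p) + d * m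
  eq₂ = solve-∀

-- The two positions of each pair add up to `suc (a + a + length xs)`, so pairs of equal values
-- contribute exactly their share of the first term. The second term pays for the unequal pairs, by
-- `pair-≤`.
zig-≤ : (h : A → ℕ) → ∀ a xs →
  2 * weighted h (suc a) (zig xs) ≤ ∑ h xs * suc (a + a + length xs) + solo h xs * length xs
zig-≤ h a [] = z≤n
zig-≤ h a (x ∷ []) = begin
  2 * (suc a * h x + 0)                    ≤⟨ m≤m+n _ (h x) ⟩
  2 * (suc a * h x + 0) + h x              ≡⟨ eq a (h x) ⟩
  (h x + 0) * suc (a + a + 1) + h x * 1    ∎
  where
  open ≤-Reasoning
  eq : ∀ a p → 2 * (suc a * p + 0) + p ≡ (p + 0) * suc (a + a + 1) + p * 1
  eq = solve-∀
zig-≤ h a (x ∷ y ∷ xs) = begin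
  2 * weighted h (suc a) (zig (x ∷ y ∷ xs))
    ≡⟨ cong (2 *_) (weighted-zigzag h (suc a) x y xs) ⟩
  2 * (suc a * p + W + (suc (suc a) + ℓ) * q)
    ≡⟨ eq₁ a p q W ℓ ⟩
  2 * (suc a * p + (suc a + suc ℓ) * q) + 2 * W
    ≤⟨ +-mono-≤ (pair-≤ (suc a) (suc ℓ) p q) (zig-≤ h (suc a) xs) ⟩
  (p + q) * (suc a + suc a + suc ℓ) + d * suc ℓ + (S * suc (suc a + suc a + ℓ) + s * ℓ)
    -- The claim weighs the solo terms with the full length `suc (suc ℓ)`, where so far `d` has the
    -- factor `suc ℓ` and `s` the factor `ℓ`.
    ≤⟨ m≤m+n _ (d + s * 2) ⟩
  (p + q) * (suc a + suc a + suc ℓ) + d * suc ℓ + (S * suc (suc a + suc a + ℓ) + s * ℓ) + (d + s * 2)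
    ≡⟨ eq₂ a p q S ℓ d s ⟩
  (p + (q + S)) * suc (a + a + suc (suc ℓ)) + (d + s) * suc (suc ℓ) ∎
  where
  open ≤-Reasoning
  p q ℓ S s d W : ℕ
  p = h x
  q = h y
  ℓ = length xs
  S = ∑ h xs
  s = solo h xs
  d = ∣ h x - h y ∣
  W = weighted h (suc (suc a)) (zig xs)
  eq₁ : ∀ a p q W ℓ → 2 * (suc a * p + W + (suc (suc a) + ℓ) * q) ≡ 2 * (suc a * p + (suc a + suc ℓ) * q) + 2 * W
  eq₁ = solve-∀
  eq₂ : ∀ a p q S ℓ d s →
    (p + q) * (suc a + suc a + suc ℓ) + d * suc ℓ + (S * suc (suc a + suc a + ℓ) + s * ℓ) + (d + s * 2) ≡
    (p + (q + S)) * suc (a + a + suc (suc ℓ)) + (d + s) * suc (suc ℓ)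
  eq₂ = solve-∀

zag-≥ : (h : A → ℕ) → ∀ a xs →
  ∑ h xs * suc (a + a + length xs) ≤ 2 * weighted h (suc a) (zag xs) + solo h xs * length xs
zag-≥ h a [] = z≤n
zag-≥ h a (x ∷ []) = ≤-trans (≤-reflexive (eq a (h x))) (m≤m+n _ _)
  where
  eq : ∀ a p → (p + 0) * suc (a + a + 1) ≡ 2 * (suc a * p + 0)
  eq = solve-∀
zag-≥ h a (x ∷ y ∷ xs) = begin
  (p + (q + S)) * suc (a + a + suc (suc ℓ))
    ≡⟨ eq₁ a p q S ℓ ⟩
  (p + q) * (suc a + suc a + suc ℓ) + S * suc (suc a + suc a + ℓ)
    ≤⟨ +-mono-≤ (pair-≥ (suc a) (suc ℓ) p q) (zag-≥ h (suc a) xs) ⟩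
  2 * (suc a * q + (suc a + suc ℓ) * p) + d * suc ℓ + (2 * W + s * ℓ)
    ≤⟨ m≤m+n _ (d + s * 2) ⟩
  2 * (suc a * q + (suc a + suc ℓ) * p) + d * suc ℓ + (2 * W + s * ℓ) + (d + s * 2)
    ≡⟨ eq₂ a p q W ℓ d s ⟩
  2 * (suc a * q + W + (suc (suc a) + ℓ) * p) + (d + s) * suc (suc ℓ)
    ≡⟨ cong (λ w → 2 * w + (d + s) * suc (suc ℓ)) (sym (weighted-zagzig h (suc a) x y xs)) ⟩
  2 * weighted h (suc a) (zag (x ∷ y ∷ xs)) + (d + s) * suc (suc ℓ) ∎
  where
  open ≤-Reasoning
  p q ℓ S s d W : ℕ
  p = h x
  q = h y
  ℓ = length xs
  S = ∑ h xs
  s = solo h xs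
  d = ∣ h x - h y ∣
  W = weighted h (suc (suc a)) (zag xs)
  eq₁ : ∀ a p q S ℓ → (p + (q + S)) * suc (a + a + suc (suc ℓ)) ≡
    (p + q) * (suc a + suc a + suc ℓ) + S * suc (suc a + suc a + ℓ)
  eq₁ = solve-∀
  eq₂ : ∀ a p q W ℓ d s →
    2 * (suc a * q + (suc a + suc ℓ) * p) + d * suc ℓ + (2 * W + s * ℓ) + (d + s * 2) ≡
    2 * (suc a * q + W + (suc (suc a) + ℓ) * p) + (d + s) * suc (suc ℓ)
  eq₂ = solve-∀

-- After its first entry the zigzag order continues as a zag, whose pairs of positions have a sum
-- larger by one. The first entry counts as paired with a value 0.
zig-≥ : (h : A → ℕ) → ∀ a xs →
  ∑ h xs * suc (suc (a + a + length xs)) ≤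
  2 * weighted h (suc a) (zig xs) + soloFrom h 0 xs * length xs
zig-≥ h a [] = z≤n
zig-≥ h a (x ∷ xs) = begin
  (p + S) * suc (suc (a + a + suc ℓ))                    ≡⟨ eq₁ a p S ℓ ⟩
  p * suc (suc (a + a + suc ℓ)) + S * suc (suc a + suc a + ℓ)
    ≤⟨ +-monoʳ-≤ (p * suc (suc (a + a + suc ℓ))) (zag-≥ h (suc a) xs) ⟩
  p * suc (suc (a + a + suc ℓ)) + (2 * W + s * ℓ)        ≤⟨ m≤m+n _ s ⟩
  p * suc (suc (a + a + suc ℓ)) + (2 * W + s * ℓ) + s    ≡⟨ eq₂ a p W s ℓ ⟩
  2 * (suc a * p + W) + (p + s) * suc ℓ                  ∎
  where
  open ≤-Reasoning
  p ℓ S s W : ℕ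
  p = h x
  ℓ = length xs
  S = ∑ h xs
  s = solo h xs
  W = weighted h (suc (suc a)) (zag xs)
  eq₁ : ∀ a p S ℓ → (p + S) * suc (suc (a + a + suc ℓ)) ≡
    p * suc (suc (a + a + suc ℓ)) + S * suc (suc a + suc a + ℓ)
  eq₁ = solve-∀
  eq₂ : ∀ a p W s ℓ → p * suc (suc (a + a + suc ℓ)) + (2 * W + s * ℓ) + s ≡
    2 * (suc a * p + W) + (p + s) * suc ℓ
  eq₂ = solve-∀

soloFrom-triangle : (h : A → ℕ) → ∀ c b xs → soloFrom h c xs ≤ ∣ c - b ∣ + soloFrom h b xs
soloFrom-triangle h c b []       = m≤∣m-n∣+n c b
soloFrom-triangle h c b (x ∷ xs) = begin
  ∣ c - h x ∣ + solo h xs               ≤⟨ +-monoˡ-≤ (solo h xs) (∣-∣-triangle c b (h x)) ⟩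
  ∣ c - b ∣ + ∣ b - h x ∣ + solo h xs   ≡⟨ +-assoc ∣ c - b ∣ _ _ ⟩
  ∣ c - b ∣ + (∣ b - h x ∣ + solo h xs) ∎
  where open ≤-Reasoning

∣m-n∣≤m+n : ∀ m n → ∣ m - n ∣ ≤ m + n
∣m-n∣≤m+n m n = ≤-trans (∣m-n∣≤m⊔n m n) (m⊔n≤m+n m n)

-- Trails in a bipartite graph with sides T and S

module Trails {n : ℕ} {E : Set} (tp sp : E → Fin n) where

  -- A trail from p to q whose ends lie in S, as a sequence of consecutive pairs of edges.
  -- The two edges of a pair need not share their T-end.
  data Trail : Fin n → Fin n → Set where
    nil  : ∀ {p} → Trail p p
    link : ∀ x y → Trail (sp x) (sp y)
    _⊕_  : ∀ {p q r} → Trail p q → Trail q r → Trail p r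

  reverseTrail : ∀ {p q} → Trail p q → Trail q p
  reverseTrail nil        = nil
  reverseTrail (link x y) = link y x
  reverseTrail (P ⊕ Q)    = reverseTrail Q ⊕ reverseTrail P

  flatten : ∀ {p q} → Trail p q → List E
  flatten nil        = []
  flatten (link x y) = x ∷ y ∷ []
  flatten (P ⊕ Q)    = flatten P ++ flatten Q

  sumPairs : (E → E → ℕ) → ∀ {p q} → Trail p q → ℕ
  sumPairs μ nil        = 0
  sumPairs μ (link x y) = μ x y
  sumPairs μ (P ⊕ Q)    = sumPairs μ P + sumPairs μ Q

  Symm : (E → E → ℕ) → Set
  Symm μ = ∀ x y → μ x y ≡ μ y x

  sumPairs-reverse : ∀ {μ} → Symm μ → ∀ {p q} (P : Trail p q) →
                     sumPairs μ (reverseTrail P) ≡ sumPairs μ P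
  sumPairs-reverse sy nil        = refl
  sumPairs-reverse sy (link x y) = sy y x
  sumPairs-reverse sy (P ⊕ Q)    =
    trans (cong₂ _+_ (sumPairs-reverse sy Q) (sumPairs-reverse sy P)) (+-comm _ (sumPairs _ P))

  both : (E → ℕ) → E → E → ℕ
  both g x y = g x + g y

  gap : (E → ℕ) → E → E → ℕ
  gap h x y = ∣ h x - h y ∣

  both-sym : ∀ g → Symm (both g)
  both-sym g x y = +-comm (g x) (g y)

  gap-sym : ∀ h → Symm (gap h)
  gap-sym h x y = ∣-∣-comm (h x) (h y)

  ∑-flatten : ∀ g {p q} (P : Trail p q) → ∑ g (flatten P) ≡ sumPairs (both g) P
  ∑-flatten g nil        = refl
  ∑-flatten g (link x y) = cong (g x +_) (+-identityʳ (g y))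
  ∑-flatten g (P ⊕ Q)    =
    trans (∑-++ g (flatten P) (flatten Q)) (cong₂ _+_ (∑-flatten g P) (∑-flatten g Q))

  solo-flatten : ∀ h {p q} (P : Trail p q) xs →
                 solo h (flatten P ++ xs) ≡ sumPairs (gap h) P + solo h xs
  solo-flatten h nil        xs = refl
  solo-flatten h (link x y) xs = refl
  solo-flatten h (P ⊕ Q)    xs = begin
    solo h ((flatten P ++ flatten Q) ++ xs)  ≡⟨ cong (solo h) (++-assoc (flatten P) _ xs) ⟩
    solo h (flatten P ++ flatten Q ++ xs)    ≡⟨ solo-flatten h P _ ⟩
    sumPairs (gap h) P + solo h (flatten Q ++ xs)
      ≡⟨ cong (sumPairs (gap h) P +_) (solo-flatten h Q xs) ⟩
    sumPairs (gap h) P + (sumPairs (gap h) Q + solo h xs)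
      ≡⟨ sym (+-assoc (sumPairs (gap h) P) _ _) ⟩
    sumPairs (gap h) (P ⊕ Q) + solo h xs ∎
    where open ≡-Reasoning

  atS : Fin n → E → ℕ
  atS v e = δ v (sp e)

  atT : Fin n → E → ℕ
  atT v e = δ v (tp e)

  -- With the cut shifted by one, the pairs inside a trail consist of edges meeting in the same end
  -- in S, so they contribute 0. Only the two ends of the trail remain.
  soloFrom-flatten : ∀ v {p q} (P : Trail p q) c xs →
    soloFrom (atS v) c (flatten P ++ xs) ≤ ∣ c - δ v p ∣ + soloFrom (atS v) (δ v q) xs
  soloFrom-flatten v {p} nil c xs = soloFrom-triangle (atS v) c (δ v p) xs
  soloFrom-flatten v (link x y) c xs = ≤-refl
  soloFrom-flatten v (_⊕_ {p} {q} {r} P Q) c xs = begin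
    soloFrom (atS v) c ((flatten P ++ flatten Q) ++ xs)
      ≡⟨ cong (soloFrom (atS v) c) (++-assoc (flatten P) _ xs) ⟩
    soloFrom (atS v) c (flatten P ++ flatten Q ++ xs)
      ≤⟨ soloFrom-flatten v P c _ ⟩
    ∣ c - δ v p ∣ + soloFrom (atS v) (δ v q) (flatten Q ++ xs)
      ≤⟨ +-monoʳ-≤ ∣ c - δ v p ∣ (soloFrom-flatten v Q (δ v q) xs) ⟩
    ∣ c - δ v p ∣ + (∣ δ v q - δ v q ∣ + soloFrom (atS v) (δ v r) xs)
      ≡⟨ cong (λ d → ∣ c - δ v p ∣ + (d + soloFrom (atS v) (δ v r) xs)) (∣n-n∣≡0 (δ v q)) ⟩
    ∣ c - δ v p ∣ + soloFrom (atS v) (δ v r) xs ∎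
    where open ≤-Reasoning

  -- Families of trails with distinct ends.

  record Path : Set where
    constructor path
    field
      {start end} : Fin n
      trail       : Trail start end

  open Path

  ends : Fin n → Path → ℕ
  ends v P = δ v (start P) + δ v (end P)

  flattenAll : List Path → List E
  flattenAll []       = []
  flattenAll (P ∷ Ps) = flatten (trail P) ++ flattenAll Ps

  sumAll : (E → E → ℕ) → List Path → ℕ
  sumAll μ = ∑ (λ P → sumPairs μ (trail P))

  ∑-flattenAll : ∀ g Ps → ∑ g (flattenAll Ps) ≡ sumAll (both g) Ps
  ∑-flattenAll g []       = refl
  ∑-flattenAll g (P ∷ Ps) =
    trans (∑-++ g (flatten (trail P)) _) (cong₂ _+_ (∑-flatten g (trail P)) (∑-flattenAll g Ps))

  solo-flattenAll : ∀ h Ps xs → solo h (flattenAll Ps ++ xs) ≡ sumAll (gap h) Ps + solo h xs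
  solo-flattenAll h []       xs = refl
  solo-flattenAll h (P ∷ Ps) xs = begin
    solo h ((flatten (trail P) ++ flattenAll Ps) ++ xs)
      ≡⟨ cong (solo h) (++-assoc (flatten (trail P)) _ xs) ⟩
    solo h (flatten (trail P) ++ flattenAll Ps ++ xs)
      ≡⟨ solo-flatten h (trail P) _ ⟩
    sumPairs (gap h) (trail P) + solo h (flattenAll Ps ++ xs)
      ≡⟨ cong (sumPairs (gap h) (trail P) +_) (solo-flattenAll h Ps xs) ⟩
    sumPairs (gap h) (trail P) + (sumAll (gap h) Ps + solo h xs)
      ≡⟨ sym (+-assoc (sumPairs (gap h) (trail P)) _ _) ⟩
    sumAll (gap h) (P ∷ Ps) + solo h xs ∎
    where open ≡-Reasoning

  -- A shifted pair that straddles two trails need not match; it costs at most one for each trail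
  -- end at `v`.
  soloFrom-flattenAll : ∀ v Ps c xs → soloFrom (atS v) c (flattenAll Ps ++ xs) ≤
                        c + ∑ (ends v) Ps + soloFrom (atS v) 0 xs
  soloFrom-flattenAll v [] c xs = begin
    soloFrom (atS v) c xs                 ≤⟨ soloFrom-triangle (atS v) c 0 xs ⟩
    ∣ c - 0 ∣ + soloFrom (atS v) 0 xs     ≡⟨ cong (_+ soloFrom (atS v) 0 xs)
                                               (trans (∣-∣-identityʳ c) (sym (+-identityʳ c))) ⟩
    c + 0 + soloFrom (atS v) 0 xs         ∎
    where open ≤-Reasoning
  soloFrom-flattenAll v (path {p} {q} P ∷ Ps) c xs = begin
    soloFrom (atS v) c ((flatten P ++ flattenAll Ps) ++ xs)
      ≡⟨ cong (soloFrom (atS v) c) (++-assoc (flatten P) _ xs) ⟩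
    soloFrom (atS v) c (flatten P ++ flattenAll Ps ++ xs)
      ≤⟨ soloFrom-flatten v P c _ ⟩
    ∣ c - δ v p ∣ + soloFrom (atS v) (δ v q) (flattenAll Ps ++ xs)
      ≤⟨ +-mono-≤ (∣m-n∣≤m+n c (δ v p)) (soloFrom-flattenAll v Ps (δ v q) xs) ⟩
    c + δ v p + (δ v q + ∑ (ends v) Ps + soloFrom (atS v) 0 xs)
      ≡⟨ eq c (δ v p) (δ v q) _ _ ⟩
    c + (δ v p + δ v q + ∑ (ends v) Ps) + soloFrom (atS v) 0 xs ∎
    where
    open ≤-Reasoning
    eq : ∀ c p q s t → c + p + (q + s + t) ≡ c + (p + q + s) + t
    eq = solve-∀

  -- The far end of the trail ending at p, if there is one, and p itself otherwise.
  record Arm (p : Fin n) (Ps : List Path) : Set where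
    field
      {far}   : Fin n
      arm     : Trail far p
      rest    : List Path
      sum-arm : ∀ μ → Symm μ → sumPairs μ arm + sumAll μ rest ≡ sumAll μ Ps
      ends-≤  : ∀ v → δ v far + ∑ (ends v) rest ≤ δ v p + ∑ (ends v) Ps
      ends-≤1 : ∀ v → δ v far + ∑ (ends v) rest ≤ 1

  private
    record Found (p : Fin n) (Ps : List Path) : Set where
      field
        {far}  : Fin n
        arm    : Trail far p
        rest   : List Path
        sum-≡  : ∀ μ → Symm μ → sumPairs μ arm + sumAll μ rest ≡ sumAll μ Ps
        ends-≡ : ∀ v → δ v far + δ v p + ∑ (ends v) rest ≡ ∑ (ends v) Ps

  find : ∀ p Ps → ∑ (ends p) Ps ≡ 0 ⊎ Found p Ps
  find p [] = inj₁ refl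
  find p (path {a} {b} P ∷ Ps) with p Fin.≟ b
  ... | yes refl = inj₂ record
    { arm = P ; rest = Ps ; sum-≡ = λ _ _ → refl ; ends-≡ = λ _ → refl }
  ... | no p≢b with p Fin.≟ a
  ...   | yes refl = inj₂ record
    { arm    = reverseTrail P
    ; rest   = Ps
    ; sum-≡  = λ μ sy → cong (_+ sumAll μ Ps) (sumPairs-reverse sy P)
    ; ends-≡ = λ v → cong (_+ ∑ (ends v) Ps) (+-comm (δ v b) (δ v a))
    }
  ...   | no p≢a with find p Ps
  ...     | inj₁ none = inj₁ none
  ...     | inj₂ f = inj₂ record
    { arm    = arm
    ; rest   = path P ∷ rest
    ; sum-≡  = λ μ sy → trans (eq₁ (sumPairs μ arm) (sumPairs μ P) _)
                          (cong (sumPairs μ P +_) (sum-≡ μ sy))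
    ; ends-≡ = λ v → trans (eq₂ (δ v far) (δ v p) (ends v (path P)) _)
                       (cong (ends v (path P) +_) (ends-≡ v))
    }
    where
    open Found f
    eq₁ : ∀ a b c → a + (b + c) ≡ b + (a + c)
    eq₁ = solve-∀
    eq₂ : ∀ a b c d → a + b + (c + d) ≡ c + (a + b + d)
    eq₂ = solve-∀

  DistinctEnds : List Path → Set
  DistinctEnds Ps = ∀ v → ∑ (ends v) Ps ≤ 1

  -- If no trail ends at `p`, the empty trail serves as the arm, and counting `p` as a further end
  -- keeps the ends distinct.
  findArm : ∀ p Ps → DistinctEnds Ps → Arm p Ps
  findArm p Ps distinct with find p Ps
  ... | inj₁ none = record
    { arm     = nil
    ; rest    = Ps
    ; sum-arm = λ _ _ → refl
    ; ends-≤  = λ _ → ≤-refl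
    ; ends-≤1 = bound
    }
    where
    bound : ∀ v → δ v p + ∑ (ends v) Ps ≤ 1
    bound v with v Fin.≟ p
    ... | yes refl = s≤s (≤-reflexive none)
    ... | no _     = distinct v
  ... | inj₂ f = record
    { arm     = arm
    ; rest    = rest
    ; sum-arm = sum-≡
    ; ends-≤  = λ v → ≤-trans (le v) (m≤n+m _ _)
    ; ends-≤1 = λ v → ≤-trans (le v) (distinct v)
    }
    where
    open Found f
    le : ∀ v → δ v far + ∑ (ends v) rest ≤ ∑ (ends v) Ps
    le v = ≤-trans (+-monoˡ-≤ _ (m≤m+n (δ v far) (δ v p))) (≤-reflexive (ends-≡ v))

  -- Restricting `sum-≡` to symmetric `μ` leaves trails free to be reversed. The instances needed
  -- are `both g`, for the edges used, and `gap h`, for the mismatches at the T-ends.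
  record Joined (x y : E) (Ps : List Path) : Set where
    field
      paths    : List Path
      distinct : DistinctEnds paths
      sum-≡    : ∀ μ → Symm μ → sumAll μ paths ≡ μ x y + sumAll μ Ps

  -- Joining x and y to the arms at their S-ends closes a cycle only if both arms
  -- are the same trail.
  join : ∀ x y {Ps} (X : Arm (sp x) Ps) → Arm.far X ≢ sp y → Joined x y Ps
  join x y {Ps} X far≢y = record
    { paths    = path (X.arm ⊕ (link x y ⊕ reverseTrail Y.arm)) ∷ Y.rest
    ; distinct = bound
    ; sum-≡    = λ μ sy → begin
        sumPairs μ X.arm + (μ x y + sumPairs μ (reverseTrail Y.arm)) + sumAll μ Y.rest
          ≡⟨ cong (λ s → sumPairs μ X.arm + (μ x y + s) + sumAll μ Y.rest) (sumPairs-reverse sy Y.arm) ⟩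
        sumPairs μ X.arm + (μ x y + sumPairs μ Y.arm) + sumAll μ Y.rest
          ≡⟨ eq (sumPairs μ X.arm) (μ x y) (sumPairs μ Y.arm) (sumAll μ Y.rest) ⟩
        μ x y + (sumPairs μ X.arm + (sumPairs μ Y.arm + sumAll μ Y.rest))
          ≡⟨ cong (λ s → μ x y + (sumPairs μ X.arm + s)) (Y.sum-arm μ sy) ⟩
        μ x y + (sumPairs μ X.arm + sumAll μ X.rest)
          ≡⟨ cong (μ x y +_) (X.sum-arm μ sy) ⟩
        μ x y + sumAll μ Ps ∎
    }
    where
    open ≡-Reasoning
    module X = Arm X
    Y : Arm (sp y) X.rest
    Y = findArm (sp y) X.rest (λ v → ≤-trans (m≤n+m _ (δ v X.far)) (X.ends-≤1 v))
    module Y = Arm Y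
    eq : ∀ a b c d → a + (b + c) + d ≡ b + (a + (c + d))
    eq = solve-∀
    bound : ∀ v → δ v X.far + δ v Y.far + ∑ (ends v) Y.rest ≤ 1
    bound v with v Fin.≟ X.far | X.ends-≤1 v
    ... | no _     | _  = Y.ends-≤1 v
    -- At `v = X.far` the bound `le` leaves no end of `X.rest`, and `far≢y` excludes that `v`
    -- becomes an end through the arm of `y`.
    ... | yes refl | le = s≤s (≤-trans (Y.ends-≤ v)
      (≤-trans (≤-reflexive (cong (_+ ∑ (ends v) X.rest) (δ-≢ far≢y))) (s≤s⁻¹ le)))

  -- The far end of the arm at `sp x` cannot be both `sp y` and `sp z`.
  pick : ∀ x y z → sp y ≢ sp z → ∀ Ps → DistinctEnds Ps →
         Joined x y Ps ⊎ Joined x z Ps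
  pick x y z y≢z Ps distinct with X ← findArm (sp x) Ps distinct | Arm.far X Fin.≟ sp y
  ... | no far≢y = inj₁ (join x y X far≢y)
  ... | yes far≡y = inj₂ (join x z X λ far≡z → y≢z (trans (sym far≡y) far≡z))

  -- Pairing off the edges at one vertex of T.

  record State : Set where
    constructor state
    field
      paths    : List Path
      distinct : DistinctEnds paths
      pending  : Maybe E

  total : (E → ℕ) → State → ℕ
  total g st = sumAll (both g) (State.paths st) + ∑ g (fromMaybe (State.pending st))

  gaps : (E → ℕ) → State → ℕ
  gaps h st = sumAll (gap h) (State.paths st) + ∑ h (fromMaybe (State.pending st))

  -- `top` is the edge kept back at `t`. Of the other edges at `t` at most one is not paired with
  -- another edge at `t`: it completes the pending edge of an earlier vertex or becomes pending
  -- itself. Hence the term `δ v t` in `gaps-≤`.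
  record Absorbed (t : Fin n) (es : List E) (st : State) : Set where
    field
      top    : E
      top-at : tp top ≡ t
      next   : State
      sum-≡  : ∀ g → total g next + g top ≡ total g st + ∑ g es
      gaps-≤ : ∀ v → gaps (atT v) next ≤ gaps (atT v) st + δ v t

  absorb-last : ∀ {t es e₀ x y Ps} (d : DistinctEnds Ps) → Joined e₀ x Ps → tp x ≡ t → tp y ≡ t →
                (∀ g → g x + g y ≡ ∑ g es) → Absorbed t es (state Ps d (just e₀))
  absorb-last {es = es} {e₀} {x} {y} {Ps} d J refl ty eq = record
    { top = y ; top-at = ty ; next = state paths distinct nothing
    ; sum-≡ = λ g → begin-equality
        sumAll (both g) paths + 0 + g y          ≡⟨ cong (λ s → s + 0 + g y) (sum-≡ (both g) (both-sym g)) ⟩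
        g e₀ + g x + sumAll (both g) Ps + 0 + g y ≡⟨ eq₁ (g e₀) (g x) (g y) (sumAll (both g) Ps) ⟩
        sumAll (both g) Ps + (g e₀ + 0) + (g x + g y) ≡⟨ cong (sumAll (both g) Ps + (g e₀ + 0) +_) (eq g) ⟩
        sumAll (both g) Ps + (g e₀ + 0) + ∑ g es ∎
    ; gaps-≤ = λ v → let h = atT v ; S = sumAll (gap h) Ps in begin
        sumAll (gap h) paths + 0    ≡⟨ cong (_+ 0) (sum-≡ (gap h) (gap-sym h)) ⟩
        -- `h e₀` was already counted while `e₀` was pending, so only `h x` is new.
        gap h e₀ x + S + 0          ≤⟨ +-monoˡ-≤ 0 (+-monoˡ-≤ S (∣m-n∣≤m+n (h e₀) (h x))) ⟩
        h e₀ + h x + S + 0          ≡⟨ eq₂ (h e₀) (h x) S ⟩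
        S + (h e₀ + 0) + h x        ∎
    }
    where
    open Joined J
    open ≤-Reasoning
    eq₁ : ∀ a b c s → a + b + s + 0 + c ≡ s + (a + 0) + (b + c)
    eq₁ = solve-∀
    eq₂ : ∀ a b s → a + b + s + 0 ≡ s + (a + 0) + b
    eq₂ = solve-∀

  absorb-pair : ∀ {t x y es es′ Ps} (d : DistinctEnds Ps) {pend} (J : Joined x y Ps) →
                tp x ≡ t → tp y ≡ t → (∀ g → g x + g y + ∑ g es ≡ ∑ g es′) →
                Absorbed t es (state (Joined.paths J) (Joined.distinct J) pend) → Absorbed t es′ (state Ps d pend)
  absorb-pair {t} {x} {y} {es} {es′} {Ps} d {pend} J tx ty eq R = record
    { top = R.top ; top-at = R.top-at ; next = R.next
    ; sum-≡ = λ g → let s = sumAll (both g) Ps ; p = ∑ g (fromMaybe pend) in begin-equality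
        total g R.next + g R.top                   ≡⟨ R.sum-≡ g ⟩
        sumAll (both g) J.paths + p + ∑ g es       ≡⟨ cong (λ s → s + p + ∑ g es) (J.sum-≡ (both g) (both-sym g)) ⟩
        g x + g y + s + p + ∑ g es                 ≡⟨ eq₁ (g x + g y) s p (∑ g es) ⟩
        s + p + (g x + g y + ∑ g es)               ≡⟨ cong (s + p +_) (eq g) ⟩
        s + p + ∑ g es′                            ∎
    ; gaps-≤ = λ v → let h = atT v ; p = ∑ h (fromMaybe pend) in begin
        gaps h R.next                              ≤⟨ R.gaps-≤ v ⟩
        sumAll (gap h) J.paths + p + δ v t         ≡⟨ cong (λ s → s + p + δ v t) (J.sum-≡ (gap h) (gap-sym h)) ⟩
        gap h x y + sumAll (gap h) Ps + p + δ v t  ≡⟨ cong (λ d → d + sumAll (gap h) Ps + p + δ v t) (same-gap v) ⟩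
        sumAll (gap h) Ps + p + δ v t              ∎
    }
    where
    open ≤-Reasoning
    module J = Joined J
    module R = Absorbed R
    eq₁ : ∀ a s p q → a + s + p + q ≡ s + p + (a + q)
    eq₁ = solve-∀
    same-gap : ∀ v → gap (atT v) x y ≡ 0
    same-gap v = m≡n⇒∣m-n∣≡0 (cong (δ v) (trans tx (sym ty)))

  -- As long as three edges remain, `pick` pairs the first with one of the next two. Of two
  -- remaining edges, one becomes pending, or is chosen by `pick` to complete the pending edge, and
  -- the other is kept back.
  absorb : ∀ {t} e es st → All (λ e → tp e ≡ t) (e ∷ es) → AllPairs (λ e e′ → sp e ≢ sp e′) (e ∷ es) →
           Absorbed t (e ∷ es) st
  absorb e [] st (te ∷ []) _ = record
    { top = e ; top-at = te ; next = st
    ; sum-≡ = λ g → cong (total g st +_) (sym (+-identityʳ (g e)))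
    ; gaps-≤ = λ v → m≤m+n _ _
    }
  absorb e (e₁ ∷ []) (state Ps d nothing) (te ∷ refl ∷ []) _ = record
    { top = e ; top-at = te ; next = state Ps d (just e₁)
    ; sum-≡ = λ g → eq (sumAll (both g) Ps) (g e₁) (g e)
    ; gaps-≤ = λ v → ≤-reflexive (eq′ (sumAll (gap (atT v)) Ps) (atT v e₁))
    }
    where
    eq : ∀ s a b → s + (a + 0) + b ≡ s + 0 + (b + (a + 0))
    eq = solve-∀
    eq′ : ∀ s a → s + (a + 0) ≡ s + 0 + a
    eq′ = solve-∀
  absorb e (e₁ ∷ []) (state Ps d (just e₀)) (te ∷ te₁ ∷ []) ((e≢e₁ ∷ []) ∷ _)
    with pick e₀ e e₁ e≢e₁ Ps d
  ... | inj₁ J = absorb-last d J te te₁ (λ g → cong (g e +_) (sym (+-identityʳ (g e₁))))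
  ... | inj₂ J = absorb-last d J te₁ te (λ g → eq (g e₁) (g e))
    where
    eq : ∀ a b → a + b ≡ b + (a + 0)
    eq = solve-∀
  absorb e (e₁ ∷ e₂ ∷ es) (state Ps d pend) (te ∷ te₁ ∷ te₂ ∷ tes)
         ((_ ∷ _) ∷ (e₁≢e₂ ∷ e₁≢es) ∷ (e₂≢es ∷ ≢es))
    with pick e e₁ e₂ e₁≢e₂ Ps d
  ... | inj₁ J = absorb-pair d J te te₁ (λ g → +-assoc (g e) (g e₁) _)
    (absorb e₂ es (state (Joined.paths J) (Joined.distinct J) pend) (te₂ ∷ tes) (e₂≢es ∷ ≢es))
  ... | inj₂ J = absorb-pair d J te te₂ (λ g → eq (g e) (g e₁) (g e₂) (∑ g es))
    (absorb e₁ es (state (Joined.paths J) (Joined.distinct J) pend) (te₁ ∷ tes) (e₁≢es ∷ ≢es))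
    where
    eq : ∀ a b c s → a + c + (b + s) ≡ a + (b + (c + s))
    eq = solve-∀

  -- Trail decomposition over all vertices of T, and its arrangement as one sequence.

  nonempty : List E → ℕ
  nonempty []      = 0
  nonempty (_ ∷ _) = 1

  module _ (F : Fin n → List E) (F-tp : ∀ t → All (λ e → tp e ≡ t) (F t))
           (F-sp : ∀ t → AllPairs (λ e e′ → sp e ≢ sp e′) (F t)) where

    record Decomposition (ts : List (Fin n)) : Set where
      field
        tops    : List E
        final   : State
        sum-≡   : ∀ g → total g final + ∑ g tops ≡ ∑ (λ t → ∑ g (F t)) ts
        gaps-≤  : ∀ v → gaps (atT v) final ≤ ∑ (δ v) ts
        tops-at : ∀ v → ∑ (atT v) tops ≡ ∑ (λ t → δ v t * nonempty (F t)) ts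

    decompose : ∀ ts → Decomposition ts
    decompose [] = record
      { tops = [] ; final = state [] (λ _ → z≤n) nothing
      ; sum-≡ = λ _ → refl ; gaps-≤ = λ _ → z≤n ; tops-at = λ _ → refl }
    decompose (t ∷ ts) = extend (F t) refl
      where
      open ≡-Reasoning
      module D = Decomposition (decompose ts)
      eq : ∀ a b c → a + b + c ≡ b + (a + c)
      eq = solve-∀
      extend : ∀ es → F t ≡ es → Decomposition (t ∷ ts)
      extend [] Ft≡ = record
        { tops = D.tops ; final = D.final
        ; sum-≡ = λ g → trans (D.sum-≡ g)
            (cong (λ es → ∑ g es + ∑ (λ t → ∑ g (F t)) ts) (sym Ft≡))
        ; gaps-≤ = λ v → ≤-trans (D.gaps-≤ v) (m≤n+m _ _)
        ; tops-at = λ v → trans (D.tops-at v)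
            (cong (_+ ∑ (λ t → δ v t * nonempty (F t)) ts)
              (trans (sym (*-zeroʳ (δ v t))) (cong (λ es → δ v t * nonempty es) (sym Ft≡))))
        }
      extend (e ∷ es) Ft≡ = record
        { tops = R.top ∷ D.tops ; final = R.next
        ; sum-≡ = λ g → begin
            total g R.next + (g R.top + ∑ g D.tops)   ≡⟨ sym (+-assoc (total g R.next) _ _) ⟩
            total g R.next + g R.top + ∑ g D.tops     ≡⟨ cong (_+ ∑ g D.tops) (R.sum-≡ g) ⟩
            total g D.final + ∑ g (e ∷ es) + ∑ g D.tops ≡⟨ eq (total g D.final) (∑ g (e ∷ es)) _ ⟩
            ∑ g (e ∷ es) + (total g D.final + ∑ g D.tops) ≡⟨ cong (∑ g (e ∷ es) +_) (D.sum-≡ g) ⟩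
            ∑ g (e ∷ es) + ∑ (λ t → ∑ g (F t)) ts
              ≡⟨ cong (λ es → ∑ g es + ∑ (λ t → ∑ g (F t)) ts) (sym Ft≡) ⟩
            ∑ g (F t) + ∑ (λ t → ∑ g (F t)) ts        ∎
        ; gaps-≤ = λ v → ≤-trans (R.gaps-≤ v)
            (≤-trans (+-monoˡ-≤ (δ v t) (D.gaps-≤ v)) (≤-reflexive (+-comm _ (δ v t))))
        ; tops-at = λ v → cong₂ _+_
            (trans (trans (cong (δ v) R.top-at) (sym (*-identityʳ (δ v t))))
                   (cong (λ es → δ v t * nonempty es) (sym Ft≡)))
            (D.tops-at v)
        }
        where
        module R = Absorbed (absorb e es D.final
          (subst (All _) Ft≡ (F-tp t)) (subst (AllPairs _) Ft≡ (F-sp t)))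

  -- Cut from the start, the sequence shows the pairs of the trails, as the vertices of T need them.
  -- The shifted cut of `soloFrom` with value 0 pairs the edges that are consecutive at S.
  record Sequence (st : State) : Set where
    field
      seq    : List E
      sum-≡  : ∀ g → ∑ g seq ≡ total g st
      solo-T : ∀ v → solo (atT v) seq ≡ gaps (atT v) st
      solo-S : ∀ v → soloFrom (atS v) 0 seq ≤ 1

  toSequence : ∀ st → Sequence st
  toSequence (state Ps d nothing) = record
    { seq    = flattenAll Ps ++ []
    ; sum-≡  = λ g → trans (∑-++ g (flattenAll Ps) []) (cong (_+ 0) (∑-flattenAll g Ps))
    ; solo-T = λ v → solo-flattenAll (atT v) Ps []
    ; solo-S = λ v → ≤-trans (soloFrom-flattenAll v Ps 0 [])
                             (≤-trans (≤-reflexive (+-identityʳ _)) (d v))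
    }
  toSequence (state Ps d (just e)) = record
    -- The pending edge is put last, where it stays unpaired for T because all trails have even
    -- length. It follows the trail ending at its own lower end, if there is one, and so adds no
    -- mismatch for S.
    { seq    = flattenAll rest ++ flatten arm ++ [ e ]
    ; sum-≡  = λ g → begin
        ∑ g (flattenAll rest ++ flatten arm ++ [ e ])
          ≡⟨ ∑-++ g (flattenAll rest) _ ⟩
        ∑ g (flattenAll rest) + ∑ g (flatten arm ++ [ e ])
          ≡⟨ cong₂ _+_ (∑-flattenAll g rest)
               (trans (∑-++ g (flatten arm) [ e ]) (cong (_+ (g e + 0)) (∑-flatten g arm))) ⟩
        sumAll (both g) rest + (sumPairs (both g) arm + (g e + 0))
          ≡⟨ eq (sumAll (both g) rest) (sumPairs (both g) arm) (g e + 0) ⟩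
        sumPairs (both g) arm + sumAll (both g) rest + (g e + 0)
          ≡⟨ cong (_+ (g e + 0)) (sum-arm (both g) (both-sym g)) ⟩
        sumAll (both g) Ps + (g e + 0) ∎
    ; solo-T = λ v → let h = atT v in begin
        solo h (flattenAll rest ++ flatten arm ++ [ e ])
          ≡⟨ solo-flattenAll h rest _ ⟩
        sumAll (gap h) rest + solo h (flatten arm ++ [ e ])
          ≡⟨ cong (sumAll (gap h) rest +_) (solo-flatten h arm [ e ]) ⟩
        sumAll (gap h) rest + (sumPairs (gap h) arm + h e)
          ≡⟨ eq (sumAll (gap h) rest) (sumPairs (gap h) arm) (h e) ⟩
        sumPairs (gap h) arm + sumAll (gap h) rest + h e
          ≡⟨ cong₂ _+_ (sum-arm (gap h) (gap-sym h)) (sym (+-identityʳ (h e))) ⟩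
        sumAll (gap h) Ps + (h e + 0) ∎
    ; solo-S = solo-S
    }
    where
    open ≡-Reasoning
    open Arm (findArm (sp e) Ps d)
    eq : ∀ a b c → a + (b + c) ≡ b + a + c
    eq = solve-∀
    solo-S : ∀ v → soloFrom (atS v) 0 (flattenAll rest ++ flatten arm ++ [ e ]) ≤ 1
    solo-S v = R.begin
      soloFrom (atS v) 0 (flattenAll rest ++ flatten arm ++ [ e ])
        R.≤⟨ soloFrom-flattenAll v rest 0 _ ⟩
      ∑ (ends v) rest + soloFrom (atS v) 0 (flatten arm ++ [ e ])
        R.≤⟨ +-monoʳ-≤ (∑ (ends v) rest) (soloFrom-flatten v arm 0 [ e ]) ⟩
      ∑ (ends v) rest + (δ v far + (∣ atS v e - atS v e ∣ + 0))
        R.≡⟨ cong (λ d → ∑ (ends v) rest + (δ v far + (d + 0))) (∣n-n∣≡0 (atS v e)) ⟩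
      ∑ (ends v) rest + (δ v far + 0)
        R.≡⟨ trans (cong (∑ (ends v) rest +_) (+-identityʳ (δ v far))) (+-comm _ (δ v far)) ⟩
      δ v far + ∑ (ends v) rest
        R.≤⟨ ends-≤1 v ⟩
      1 R.∎
      where module R = ≤-Reasoning

-- Indicator sums, and the bounds for one layer.

weighted-cong : {h k : A → ℕ} → ∀ a {xs} → All (λ x → h x ≡ k x) xs → weighted h a xs ≡ weighted k a xs
weighted-cong a []       = refl
weighted-cong a (p ∷ ps) = cong₂ _+_ (cong (a *_) p) (weighted-cong (suc a) ps)

∑-↭ : (g : A → ℕ) {xs ys : List A} → xs ↭ ys → ∑ g xs ≡ ∑ g ys
∑-↭ g p = sum-↭ (map⁺ g p)

All⇒∑≡0 : {g : A → ℕ} {xs : List A} → All (λ x → g x ≡ 0) xs → ∑ g xs ≡ 0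
All⇒∑≡0 {xs = xs} ps = trans (∑-cong-All ps) (∑-zero xs)

𝟙-¬≡0 : {P : Set} (P? : Dec P) → 𝟙 (¬? P?) ≡ 0 → P
𝟙-¬≡0 (yes p) _ = p

∑-indicator : (_≟ᴬ_ : DecidableEquality A) {x : A} (f : A → ℕ) {xs : List A} → Unique xs → x ∈ xs →
              ∑ (λ y → 𝟙 (x ≟ᴬ y) * f y) xs ≡ f x
∑-indicator _≟ᴬ_ {x} f (x≢xs ∷ _) (here refl) = begin
  𝟙 (x ≟ᴬ x) * f x + _   ≡⟨ cong₂ _+_ (cong (_* f x) (𝟙-yes (x ≟ᴬ x) refl))
                              (All⇒∑≡0 (All.map (λ {y} x≢y → cong (_* f y) (𝟙-no (x ≟ᴬ y) x≢y)) x≢xs)) ⟩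
  1 * f x + 0            ≡⟨ trans (+-identityʳ _) (*-identityˡ (f x)) ⟩
  f x                    ∎
  where open ≡-Reasoning
∑-indicator _≟ᴬ_ {x} f {y ∷ xs} (y≢xs ∷ u) (there x∈xs) =
  trans (cong (λ d → d * f y + ∑ (λ y → 𝟙 (x ≟ᴬ y) * f y) xs)
          (𝟙-no (x ≟ᴬ y) (λ x≡y → All.lookup y≢xs x∈xs (sym x≡y))))
        (∑-indicator _≟ᴬ_ f u x∈xs)

∑-δ : ∀ {n} (x : Fin n) (f : Fin n → ℕ) → ∑ (λ y → δ x y * f y) (allFin n) ≡ f x
∑-δ {n} x f = ∑-indicator Fin._≟_ f (allFin⁺ n) (∈-allFin x)

-- If `s = 1`, then `D` is odd, so `R` is odd as well and cannot be 0.
solo≤rest : ∀ K {R D s} → R + D ≡ K + K → s ≤ 1 → Even (s + D) → s ≤ R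
solo≤rest K {R}     {D} {zero}        _  _         _        = z≤n
solo≤rest K {suc R} {D} {suc zero}    _  _         _        = s≤s z≤n
solo≤rest K {zero}  {D} {suc zero}    eq _ (j , eq′) =
  contradiction (trans (double j) (trans (sym eq′) (cong suc (trans eq (sym (double K)))))) (even≢odd j K)
  where
  double : ∀ m → 2 * m ≡ m + m
  double = solve-∀
solo≤rest K {R}     {D} {suc (suc s)} _  (s≤s ())  _

-- Twice the average of the labels A + 1, …, A + N is c = 2 A + N + 1.  A label outside this
-- interval is far enough from c / 2 to make up for a solo edge, and by parity there is such a
-- label at a vertex with a solo edge.
level-≤ : ∀ K A N {R D s x y} → R + D ≡ K + K → s ≤ 1 → Even (s + D) →
          x ≤ A * R → 2 * y ≤ D * suc (A + A + N) + s * N → x + y ≤ K * suc (A + A + N)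
level-≤ K A N {R} {D} {s} {x} {y} eq s≤1 even x≤ y≤ = *-cancelˡ-≤ 2 (begin
  2 * (x + y)                             ≡⟨ *-distribˡ-+ 2 x y ⟩
  2 * x + 2 * y                           ≤⟨ +-mono-≤ (*-monoʳ-≤ 2 x≤) y≤ ⟩
  2 * (A * R) + (D * c + s * N)           ≤⟨ +-monoʳ-≤ (2 * (A * R)) (+-monoʳ-≤ (D * c)
                                               (*-monoˡ-≤ N (solo≤rest K eq s≤1 even))) ⟩
  2 * (A * R) + (D * c + R * N)           ≤⟨ m≤m+n _ R ⟩
  2 * (A * R) + (D * c + R * N) + R       ≡⟨ eq₁ A N R D ⟩
  (R + D) * c                             ≡⟨ cong (_* c) eq ⟩
  (K + K) * c                             ≡⟨ eq₂ K c ⟩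
  2 * (K * c)                             ∎)
  where
  open ≤-Reasoning
  c : ℕ
  c = suc (A + A + N)
  eq₁ : ∀ A N R D → 2 * (A * R) + (D * suc (A + A + N) + R * N) + R ≡ (R + D) * suc (A + A + N)
  eq₁ = solve-∀
  eq₂ : ∀ K c → (K + K) * c ≡ 2 * (K * c)
  eq₂ = solve-∀

-- The shifted pairs have label sum `c = 2 A + N + 2`. Each of the `R` labels, taken as `A + N + 1`,
-- exceeds `c / 2` by `N / 2`, which is what a solo edge may lose.
level-≥ : ∀ K A N {R D s y} → R + D ≡ K + K → s ≤ 1 → Even (s + D) →
          D * suc (suc (A + A + N)) ≤ 2 * y + s * N →
          K * suc (suc (A + A + N)) ≤ y + R * suc (A + N)
level-≥ K A N {R} {D} {s} {y} eq s≤1 even ≤y = *-cancelˡ-≤ 2 (begin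
  2 * (K * c)                   ≡⟨ eq₁ K c ⟩
  (K + K) * c                   ≡⟨ cong (_* c) (sym eq) ⟩
  (R + D) * c                   ≡⟨ *-distribʳ-+ c R D ⟩
  R * c + D * c                 ≤⟨ +-monoʳ-≤ (R * c) (≤-trans ≤y
                                     (+-monoʳ-≤ (2 * y) (*-monoˡ-≤ N (solo≤rest K eq s≤1 even)))) ⟩
  R * c + (2 * y + R * N)       ≡⟨ eq₂ A N R y ⟩
  2 * (y + R * suc (A + N))     ∎)
  where
  open ≤-Reasoning
  c : ℕ
  c = suc (suc (A + A + N))
  eq₁ : ∀ K c → 2 * (K * c) ≡ (K + K) * c
  eq₁ = solve-∀
  eq₂ : ∀ A N R y → R * suc (suc (A + A + N)) + (2 * y + R * N) ≡ 2 * (y + R * suc (A + N))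
  eq₂ = solve-∀

-- Distinct sums from labels given out in sorted order.

module _ {n : ℕ} (key : Fin n → ℕ) (f : A → Fin n) where

  private
    SortedByKey : List A → Set
    SortedByKey = AllPairs (λ x y → key (f x) ≤ key (f y))

    once : Fin n → List A → Set
    once v xs = ∑ (δ v ∘ f) xs ≡ 1

    head-< : ∀ b x xs {v} → SortedByKey (x ∷ xs) → once (f x) (x ∷ xs) → f x ≢ v → once v (x ∷ xs) →
             key (f x) + weighted (δ (f x) ∘ f) (suc b) (x ∷ xs) <
             key v + weighted (δ v ∘ f) (suc b) (x ∷ xs)
    head-< b x xs {v} (x≤xs ∷ _) once-x x≢v once-v = begin-strict
      key (f x) + (suc b * δ (f x) (f x) + weighted (δ (f x) ∘ f) (suc (suc b)) xs)
        ≡⟨ cong (key (f x) +_) (cong₂ _+_ (trans (cong (suc b *_) (δ-refl (f x))) (*-identityʳ (suc b)))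
                                          (weighted-∑≡0 (δ (f x) ∘ f) (suc b) xs rest-0)) ⟩
      key (f x) + (suc b + 0)
        ≤⟨ +-monoˡ-≤ (suc b + 0) key-≤ ⟩
      key v + (suc b + 0)
        <⟨ +-monoʳ-< (key v) (≤-reflexive (eq b)) ⟩
      key v + suc (suc b) * 1
        ≡⟨ cong (λ s → key v + suc (suc b) * s) (sym rest-1) ⟩
      key v + suc (suc b) * ∑ (δ v ∘ f) xs
        ≤⟨ +-monoʳ-≤ (key v) (weighted-≥ (δ v ∘ f) (suc (suc b)) xs) ⟩
      key v + weighted (δ v ∘ f) (suc (suc b)) xs
        ≤⟨ +-monoʳ-≤ (key v) (m≤n+m _ (suc b * δ v (f x))) ⟩
      key v + weighted (δ v ∘ f) (suc b) (x ∷ xs) ∎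
      where
      open ≤-Reasoning
      eq : ∀ b → suc (suc b + 0) ≡ suc (suc b) * 1
      eq = solve-∀
      rest-0 : ∑ (δ (f x) ∘ f) xs ≡ 0
      rest-0 = suc-injective (trans (cong (_+ ∑ (δ (f x) ∘ f) xs) (sym (δ-refl (f x)))) once-x)
      rest-1 : ∑ (δ v ∘ f) xs ≡ 1
      rest-1 = trans (cong (_+ ∑ (δ v ∘ f) xs) (sym (δ-≢ (x≢v ∘ sym)))) once-v
      key-≤ : key (f x) ≤ key v
      key-≤ with y , y∈xs , pos ← ∑-positive (δ v ∘ f) xs (≤-reflexive (sym rest-1))
        = subst (λ u → key (f x) ≤ key u) (sym (𝟙-positive (v Fin.≟ f y) pos)) (All.lookup x≤xs y∈xs)

  -- Each of `u` and `v` owns exactly one entry. The one whose entry comes first has a key that is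
  -- no larger and a strictly smaller position.
  sorted-distinct : ∀ b xs → AllPairs (λ x y → key (f x) ≤ key (f y)) xs → ∀ {u v} → u ≢ v →
                    ∑ (δ u ∘ f) xs ≡ 1 → ∑ (δ v ∘ f) xs ≡ 1 →
                    key u + weighted (δ u ∘ f) (suc b) xs ≢ key v + weighted (δ v ∘ f) (suc b) xs
  sorted-distinct b (x ∷ xs) sorted@(_ ∷ sorted′) {u} {v} u≢v once-u once-v sums≡ =
    by-cases (u Fin.≟ f x) (v Fin.≟ f x)
    where
    tail : ∀ {w} → w ≢ f x → ∀ {m} → suc b * δ w (f x) + m ≡ m
    tail w≢ {m} = trans (cong (λ d → suc b * d + m) (δ-≢ w≢)) (cong (_+ m) (*-zeroʳ (suc b)))
    tail-∑ : ∀ {w} → w ≢ f x → ∑ (δ w ∘ f) (x ∷ xs) ≡ 1 → ∑ (δ w ∘ f) xs ≡ 1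
    tail-∑ w≢ = trans (cong (_+ _) (sym (δ-≢ w≢)))
    by-cases : Dec (u ≡ f x) → Dec (v ≡ f x) → ⊥
    by-cases (yes refl) _          = <⇒≢ (head-< b x xs sorted once-u u≢v once-v) sums≡
    by-cases (no _)     (yes refl) = <⇒≢ (head-< b x xs sorted once-v (u≢v ∘ sym) once-u) (sym sums≡)
    by-cases (no u≢)    (no v≢)    =
      sorted-distinct (suc b) xs sorted′ u≢v (tail-∑ u≢ once-u) (tail-∑ v≢ once-v)
        (trans (cong (key u +_) (sym (tail u≢))) (trans sums≡ (cong (key v +_) (tail v≢))))

-- Layered graphs: every edge e joins its upper end tp e, of rank ρ (tp e), to an end sp e
-- of the same rank or of rank one less.

module Layers {n : ℕ} {E : Set} (tp sp : E → Fin n) (edges : List E) (ρ : Fin n → ℕ) where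

  ι : Fin n → E → ℕ
  ι v e = δ v (tp e) + δ v (sp e)

  Up : E → Set
  Up e = ρ (tp e) ≡ suc (ρ (sp e))

  UpAt : Fin n → E → Set
  UpAt t e = tp e ≡ t × Up e

  upAt? : ∀ t → Unary.Decidable (UpAt t)
  upAt? t e = (tp e Fin.≟ t) ×-dec (ρ (tp e) ≟ suc (ρ (sp e)))

  upEdges : Fin n → List E
  upEdges t = filter (upAt? t) edges

  Flat : ℕ → E → Set
  Flat l e = ρ (tp e) ≡ l × ρ (sp e) ≡ l

  flat? : ∀ l → Unary.Decidable (Flat l)
  flat? l e = (ρ (tp e) ≟ l) ×-dec (ρ (sp e) ≟ l)

  flatEdges : ℕ → List E
  flatEdges l = filter (flat? l) edges

  layer : ℕ → List (Fin n)
  layer l = filter (λ v → ρ v ≟ l) (allFin n)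

  ∑-layer : ∀ v (f : Fin n → ℕ) l → ∑ (λ t → δ v t * f t) (layer l) ≡ 𝟙 (ρ v ≟ l) * f v
  ∑-layer v f l = begin
    ∑ (λ t → δ v t * f t) (layer l)                      ≡⟨ ∑-filter (λ v → ρ v ≟ l) _ (allFin n) ⟩
    ∑ (λ t → 𝟙 (ρ t ≟ l) * (δ v t * f t)) (allFin n)      ≡⟨ ∑-cong (λ t → eq (𝟙 (ρ t ≟ l)) (δ v t) (f t)) (allFin n) ⟩
    ∑ (λ t → δ v t * (𝟙 (ρ t ≟ l) * f t)) (allFin n)      ≡⟨ ∑-δ v _ ⟩
    𝟙 (ρ v ≟ l) * f v                                    ∎
    where
    open ≡-Reasoning
    eq : ∀ a b c → a * (b * c) ≡ b * (a * c)
    eq = solve-∀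

  upEdges-tp : ∀ t → All (λ e → tp e ≡ t) (upEdges t)
  upEdges-tp t = All.map proj₁ (all-filter (upAt? t) edges)

  ∑-upEdges-tp : ∀ v t → ∑ (λ e → δ v (tp e)) (upEdges t) ≡ δ v t * length (upEdges t)
  ∑-upEdges-tp v t = begin
    ∑ (λ e → δ v (tp e)) (upEdges t) ≡⟨ ∑-cong-All (All.map (cong (δ v)) (upEdges-tp t)) ⟩
    ∑ (λ _ → δ v t) (upEdges t)      ≡⟨ ∑-cong (λ _ → sym (*-identityˡ (δ v t))) (upEdges t) ⟩
    ∑ (λ _ → 1 * δ v t) (upEdges t)  ≡⟨ ∑-*ʳ (λ _ → 1) (δ v t) (upEdges t) ⟩
    ∑ (λ _ → 1) (upEdges t) * δ v t  ≡⟨ cong (_* δ v t) (∑-1 (upEdges t)) ⟩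
    length (upEdges t) * δ v t       ≡⟨ *-comm (length (upEdges t)) (δ v t) ⟩
    δ v t * length (upEdges t)       ∎
    where open ≡-Reasoning

  module _ (rank : ∀ e → ρ (tp e) ≡ ρ (sp e) ⊎ Up e) where

    sp≤tp : ∀ e → ρ (sp e) ≤ ρ (tp e)
    sp≤tp e with rank e
    ... | inj₁ eq = ≤-reflexive (sym eq)
    ... | inj₂ eq = ≤-trans (n≤1+n _) (≤-reflexive (sym eq))

    tp≤1+sp : ∀ e → ρ (tp e) ≤ suc (ρ (sp e))
    tp≤1+sp e with rank e
    ... | inj₁ eq = ≤-trans (≤-reflexive eq) (n≤1+n _)
    ... | inj₂ eq = ≤-reflexive eq

    -- By `rank` an edge is either flat or up, and an up edge is counted only at `t = tp e`.
    flat-or-up : ∀ l e → 𝟙 (flat? l e) + ∑ (λ t → 𝟙 (upAt? t e)) (layer l) ≡ 𝟙 (ρ (tp e) ≟ l)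
    flat-or-up l e with rank e
    ... | inj₂ up = cong₂ _+_ (𝟙-no (flat? l e) not-flat) (begin
          ∑ (λ t → 𝟙 (upAt? t e)) (layer l)         ≡⟨ ∑-cong as-δ (layer l) ⟩
          ∑ (λ t → δ (tp e) t * 1) (layer l)        ≡⟨ ∑-layer (tp e) (λ _ → 1) l ⟩
          𝟙 (ρ (tp e) ≟ l) * 1                      ≡⟨ *-identityʳ _ ⟩
          𝟙 (ρ (tp e) ≟ l)                          ∎)
      where
      open ≡-Reasoning
      not-flat : ¬ Flat l e
      not-flat (p , q) = 1+n≢n (trans (sym up) (trans p (sym q)))
      as-δ : ∀ t → 𝟙 (upAt? t e) ≡ δ (tp e) t * 1
      as-δ t = trans (𝟙-cong (upAt? t e) (tp e Fin.≟ t) proj₁ (_, up)) (sym (*-identityʳ _))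
    ... | inj₁ flat = begin
          𝟙 (flat? l e) + ∑ (λ t → 𝟙 (upAt? t e)) (layer l)
            ≡⟨ cong₂ _+_ (𝟙-cong (flat? l e) (ρ (tp e) ≟ l) proj₁ (λ p → p , trans (sym flat) p))
                 (trans (∑-cong (λ t → 𝟙-no (upAt? t e) (¬up ∘ proj₂)) (layer l)) (∑-zero (layer l))) ⟩
          𝟙 (ρ (tp e) ≟ l) + 0
            ≡⟨ +-identityʳ _ ⟩
          𝟙 (ρ (tp e) ≟ l) ∎
      where
      open ≡-Reasoning
      ¬up : ¬ Up e
      ¬up up = 1+n≢n (trans (sym up) flat)

    ∑-level : ∀ l (g : E → ℕ) → ∑ g (flatEdges l) + ∑ (λ t → ∑ g (upEdges t)) (layer l) ≡
              ∑ (λ e → 𝟙 (ρ (tp e) ≟ l) * g e) edges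
    ∑-level l g = begin
      ∑ g (flatEdges l) + ∑ (λ t → ∑ g (upEdges t)) (layer l)
        ≡⟨ cong₂ _+_ (∑-filter (flat? l) g edges)
             (trans (∑-cong (λ t → ∑-filter (upAt? t) g edges) (layer l))
                    (∑-swap (λ t e → 𝟙 (upAt? t e) * g e) (layer l) edges)) ⟩
      ∑ (λ e → 𝟙 (flat? l e) * g e) edges + ∑ (λ e → ∑ (λ t → 𝟙 (upAt? t e) * g e) (layer l)) edges
        ≡⟨ sym (∑-+ _ _ edges) ⟩
      ∑ (λ e → 𝟙 (flat? l e) * g e + ∑ (λ t → 𝟙 (upAt? t e) * g e) (layer l)) edges
        ≡⟨ ∑-cong pointwise edges ⟩
      ∑ (λ e → 𝟙 (ρ (tp e) ≟ l) * g e) edges ∎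
      where
      open ≡-Reasoning
      pointwise : ∀ e → 𝟙 (flat? l e) * g e + ∑ (λ t → 𝟙 (upAt? t e) * g e) (layer l) ≡ 𝟙 (ρ (tp e) ≟ l) * g e
      pointwise e = begin
        𝟙 (flat? l e) * g e + ∑ (λ t → 𝟙 (upAt? t e) * g e) (layer l)
          ≡⟨ cong (𝟙 (flat? l e) * g e +_) (∑-*ʳ (λ t → 𝟙 (upAt? t e)) (g e) (layer l)) ⟩
        𝟙 (flat? l e) * g e + ∑ (λ t → 𝟙 (upAt? t e)) (layer l) * g e
          ≡⟨ sym (*-distribʳ-+ (g e) (𝟙 (flat? l e)) _) ⟩
        (𝟙 (flat? l e) + ∑ (λ t → 𝟙 (upAt? t e)) (layer l)) * g e
          ≡⟨ cong (_* g e) (flat-or-up l e) ⟩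
        𝟙 (ρ (tp e) ≟ l) * g e ∎

-- Induction over the layers, from the highest rank downwards.

module Levels {n : ℕ} {E : Set} (tp sp : E → Fin n) (edges : List E) (ρ : Fin n → ℕ) (K : ℕ)
  (0<K      : 0 < K)
  (rank     : ∀ e → ρ (tp e) ≡ ρ (sp e) ⊎ ρ (tp e) ≡ suc (ρ (sp e)))
  (regular  : ∀ v → ∑ (λ e → δ v (tp e) + δ v (sp e)) edges ≡ suc (K + K))
  (simple   : ∀ t → AllPairs (λ e e′ → sp e ≢ sp e′) (Layers.upEdges tp sp edges ρ t))
  (grounded : ∀ v → (∃ λ e → e ∈ edges × Layers.UpAt tp sp edges ρ v e) ⊎ (∀ u → ρ u ≡ ρ v → u ≡ v))
  where

  open Layers tp sp edges ρ
  open Trails tp sp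

  ι≡0 : ∀ {v e} → v ≢ tp e → v ≢ sp e → ι v e ≡ 0
  ι≡0 v≢tp v≢sp = cong₂ _+_ (δ-≢ v≢tp) (δ-≢ v≢sp)

  ρ-≢ : ∀ {u v} → ρ u ≢ ρ v → u ≢ v
  ρ-≢ ρu≢ρv refl = ρu≢ρv refl

  vsum : Fin n → List E → ℕ
  vsum v = weighted (ι v) 1

  -- xs is, up to order, the list of all edges whose upper end has rank at least l.
  Complete : ℕ → List E → Set
  Complete l xs = ∀ g → ∑ g xs ≡ ∑ (λ e → 𝟙 (l ≤? ρ (tp e)) * g e) edges

  -- An edge missing from `xs` has both ends of rank below `l`.
  full : ∀ {l xs v} → Complete l xs → l ≤ ρ v → ∑ (ι v) xs ≡ suc (K + K)
  full {l} {xs} {v} complete l≤ρv = trans (complete (ι v)) (trans (∑-cong pointwise edges) (regular v))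
    where
    pointwise : ∀ e → 𝟙 (l ≤? ρ (tp e)) * ι v e ≡ ι v e
    pointwise e with l ≤? ρ (tp e)
    ... | yes _ = *-identityˡ (ι v e)
    ... | no l≰ = sym (ι≡0 {v} {e} (ρ-≢ (>⇒≢ tp<v)) (ρ-≢ (>⇒≢ (≤-<-trans (sp≤tp rank e) tp<v))))
      where
      tp<v : ρ (tp e) < ρ v
      tp<v = <-≤-trans (≰⇒> l≰) l≤ρv

  -- An edge in `xs` has both ends of rank at least `l − 1`.
  absent : ∀ {l xs v} → Complete l xs → suc (ρ v) < l → ∑ (ι v) xs ≡ 0
  absent {l} {xs} {v} complete ρv<l = trans (complete (ι v)) (trans (∑-cong pointwise edges) (∑-zero edges))
    where
    pointwise : ∀ e → 𝟙 (l ≤? ρ (tp e)) * ι v e ≡ 0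
    pointwise e with l ≤? ρ (tp e)
    ... | no _   = refl
    ... | yes l≤ = cong (_+ 0) (ι≡0 {v} {e} (ρ-≢ (<⇒≢ (<-trans (n<1+n _) v<tp)))
                                    (ρ-≢ (<⇒≢ (s<s⁻¹ (<-≤-trans v<tp (tp≤1+sp rank e))))))
      where
      v<tp : suc (ρ v) < ρ (tp e)
      v<tp = <-≤-trans ρv<l l≤

  -- The labels are the positions in `acc`, counted from 1. The threshold `K * c + length acc`
  -- separates the finished layers from the next one; after a step, `c` is the label sum of the
  -- pairs in the last zigzag. `c≤` ensures that `c` does not decrease.
  record Invariant (l : ℕ) (acc : List E) : Set where
    field
      complete : Complete l acc
      c        : ℕ
      c≤       : c ≤ suc (length acc + length acc)
      upper    : ∀ v → l ≤ ρ v → vsum v acc ≤ K * c + length acc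
      -- r is the number of edges at u without a label; their labels will exceed length acc.
      lower    : ∀ u r → suc (ρ u) ≡ l → ∑ (ι u) acc + r ≡ suc (K + K) →
                 K * c + length acc < vsum u acc + r * suc (length acc)
      distinct : ∀ {u v} → l ≤ ρ u → l ≤ ρ v → u ≢ v → vsum u acc ≢ vsum v acc

  module Step (l : ℕ) (acc : List E) (I : Invariant (suc l) acc) where

    module I = Invariant I

    flats : List E
    flats = flatEdges l

    module D = Decomposition (decompose upEdges upEdges-tp simple (layer l))
    module Q = Sequence (toSequence D.final)

    L tops : List E
    L    = Q.seq
    tops = D.tops

    ∑-L-tops : ∀ g → ∑ g L + ∑ g tops ≡ ∑ (λ t → ∑ g (upEdges t)) (layer l)
    ∑-L-tops g = trans (cong (_+ ∑ g tops) (Q.sum-≡ g)) (D.sum-≡ g)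

    Between : E → Set
    Between e = ρ (tp e) ≡ l × suc (ρ (sp e)) ≡ l

    between? : Unary.Decidable Between
    between? e = (ρ (tp e) ≟ l) ×-dec (suc (ρ (sp e)) ≟ l)

    not-between : E → ℕ
    not-between e = 𝟙 (¬? (between? e))

    -- The sum identity `∑-L-tops` carries a property from the up edges to `L` and `tops` when it is
    -- applied to the indicator of failure.
    none-outside : ∑ not-between L + ∑ not-between tops ≡ 0
    none-outside = trans (∑-L-tops not-between)
      (All⇒∑≡0 (All.map (λ ρt≡l → All⇒∑≡0 (All.map (inside ρt≡l) (all-filter (upAt? _) edges)))
                        (all-filter (λ v → ρ v ≟ l) (allFin n))))
      where
      inside : ∀ {t} → ρ t ≡ l → ∀ {e} → UpAt t e → not-between e ≡ 0
      inside ρt≡l {e} (refl , up) = 𝟙-no (¬? (between? e)) (λ ¬b → ¬b (ρt≡l , trans (sym up) ρt≡l))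

    L-between : All Between L
    L-between = All.map (λ {e} → 𝟙-¬≡0 (between? e))
                        (∑≡0⇒All not-between L (m+n≡0⇒m≡0 _ none-outside))

    tops-between : All Between tops
    tops-between = All.map (λ {e} → 𝟙-¬≡0 (between? e))
                           (∑≡0⇒All not-between tops (m+n≡0⇒n≡0 (∑ not-between L) none-outside))

    ι-T : ∀ {v} → ρ v ≡ l → ∀ {e} → Between e → ι v e ≡ δ v (tp e)
    ι-T {v} ρv≡l {e} (_ , sp≡) = trans (cong (δ v (tp e) +_) (δ-≢ (ρ-≢ λ eq →
      1+n≢n (trans sp≡ (trans (sym ρv≡l) eq))))) (+-identityʳ _)

    ι-S : ∀ {u} → suc (ρ u) ≡ l → ∀ {e} → Between e → ι u e ≡ δ u (sp e)
    ι-S {u} ρu≡l {e} (tp≡ , _) = cong (_+ δ u (sp e)) (δ-≢ (ρ-≢ λ eq →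
      1+n≢n (trans ρu≡l (trans (sym tp≡) (sym eq)))))

    base : List E
    base = acc ++ flats

    -- For a vertex of layer `l` this is the vertex sum without the edge kept back.
    partial : Fin n → ℕ
    partial v = vsum v (base ++ zig L)

    byPartial : DecTotalOrder _ _ _
    byPartial = On.decTotalOrder ≤-decTotalOrder (partial ∘ tp)

    open Data.List.Sort byPartial using (sort; sort-↭; sort-↗)

    sorted : List E
    sorted = sort tops

    new : List E
    new = (base ++ zig L) ++ sorted

    a b N M : ℕ
    a = length acc
    b = length base
    N = length L
    M = length sorted

    c′ : ℕ
    c′ = suc (b + b + N)

    sorted-between : All Between sorted
    sorted-between = All-resp-↭ (↭-sym (sort-↭ tops)) tops-between

    ∑-sorted : ∀ g → ∑ g sorted ≡ ∑ g tops
    ∑-sorted g = ∑-↭ g (sort-↭ tops)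

    length-bN : length (base ++ zig L) ≡ b + N
    length-bN = trans (length-++ base) (cong (b +_) (length-zig L))

    length-new : length new ≡ b + N + M
    length-new = trans (length-++ (base ++ zig L)) (cong (_+ M) length-bN)

    a≤b : a ≤ b
    a≤b = ≤-trans (m≤m+n a _) (≤-reflexive (sym (length-++ acc)))

    bN≤new : b + N ≤ length new
    bN≤new = ≤-trans (m≤m+n _ M) (≤-reflexive (sym length-new))

    b≤new : b ≤ length new
    b≤new = ≤-trans (m≤m+n b N) bN≤new

    ∑-new : ∀ g → ∑ g new ≡ ∑ g acc + ∑ g flats + ∑ g L + ∑ g tops
    ∑-new g = begin
      ∑ g ((base ++ zig L) ++ sorted)                ≡⟨ ∑-++ g (base ++ zig L) sorted ⟩
      ∑ g (base ++ zig L) + ∑ g sorted               ≡⟨ cong₂ _+_ (∑-++ g base (zig L)) (∑-sorted g) ⟩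
      ∑ g base + ∑ g (zig L) + ∑ g tops              ≡⟨ cong (_+ ∑ g tops) (cong₂ _+_ (∑-++ g acc flats) (∑-zig g L)) ⟩
      ∑ g acc + ∑ g flats + ∑ g L + ∑ g tops         ∎
      where open ≡-Reasoning

    weight-flats weight-L weight-tops : Fin n → ℕ
    weight-flats v = weighted (ι v) (suc a) flats
    weight-L v     = weighted (ι v) (suc b) (zig L)
    weight-tops v  = weighted (ι v) (suc (b + N)) sorted

    vsum-base : ∀ v → vsum v base ≡ vsum v acc + weight-flats v
    vsum-base v = weighted-++ (ι v) 1 acc flats

    partial-≡ : ∀ v → partial v ≡ vsum v base + weight-L v
    partial-≡ v = weighted-++ (ι v) 1 base (zig L)

    vsum-new′ : ∀ v → vsum v new ≡ partial v + weight-tops v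
    vsum-new′ v = trans (weighted-++ (ι v) 1 (base ++ zig L) sorted)
      (cong (λ b → partial v + weighted (ι v) (suc b) sorted) length-bN)

    vsum-new : ∀ v → vsum v new ≡ vsum v acc + weight-flats v + weight-L v + weight-tops v
    vsum-new v = trans (vsum-new′ v) (cong (_+ weight-tops v)
      (trans (partial-≡ v) (cong (_+ weight-L v) (vsum-base v))))

    complete : Complete l new
    complete g = begin
      ∑ g new                                            ≡⟨ ∑-new g ⟩
      ∑ g acc + ∑ g flats + ∑ g L + ∑ g tops             ≡⟨ eq (∑ g acc) (∑ g flats) _ _ ⟩
      ∑ g acc + (∑ g flats + (∑ g L + ∑ g tops))         ≡⟨ cong (λ s → ∑ g acc + (∑ g flats + s)) (∑-L-tops g) ⟩
      ∑ g acc + (∑ g flats + ∑ (λ t → ∑ g (upEdges t)) (layer l))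
        ≡⟨ cong₂ _+_ (I.complete g) (∑-level rank l g) ⟩
      ∑ (λ e → 𝟙 (suc l ≤? ρ (tp e)) * g e) edges + ∑ (λ e → 𝟙 (ρ (tp e) ≟ l) * g e) edges
        ≡⟨ sym (∑-+ _ _ edges) ⟩
      ∑ (λ e → 𝟙 (suc l ≤? ρ (tp e)) * g e + 𝟙 (ρ (tp e) ≟ l) * g e) edges
        ≡⟨ ∑-cong (λ e → trans (sym (*-distribʳ-+ (g e) (𝟙 (suc l ≤? ρ (tp e))) _))
                               (cong (_* g e) (split (ρ (tp e))))) edges ⟩
      ∑ (λ e → 𝟙 (l ≤? ρ (tp e)) * g e) edges ∎
      where
      open ≡-Reasoning
      eq : ∀ a b c d → a + b + c + d ≡ a + (b + (c + d))
      eq = solve-∀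
      split : ∀ m → 𝟙 (suc l ≤? m) + 𝟙 (m ≟ l) ≡ 𝟙 (l ≤? m)
      split m with <-cmp l m
      ... | tri< l<m l≢m _ = trans (cong₂ _+_ (𝟙-yes (suc l ≤? m) l<m) (𝟙-no (m ≟ l) (l≢m ∘ sym)))
                                   (sym (𝟙-yes (l ≤? m) (<⇒≤ l<m)))
      ... | tri≈ l≮m l≡m _ = trans (cong₂ _+_ (𝟙-no (suc l ≤? m) l≮m) (𝟙-yes (m ≟ l) (sym l≡m)))
                                   (sym (𝟙-yes (l ≤? m) (≤-reflexive l≡m)))
      ... | tri> l≮m l≢m m<l = trans (cong₂ _+_ (𝟙-no (suc l ≤? m) l≮m) (𝟙-no (m ≟ l) (l≢m ∘ sym)))
                                   (sym (𝟙-no (l ≤? m) (<⇒≱ m<l)))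

    -- The edges at a vertex of rank above l are already in acc.
    old : ∀ {v} → suc l ≤ ρ v → vsum v new ≡ vsum v acc
    old {v} l<ρv = begin
      vsum v new                                                      ≡⟨ vsum-new v ⟩
      vsum v acc + weight-flats v + weight-L v + weight-tops v
        ≡⟨ cong₂ _+_ (cong₂ _+_ (cong (vsum v acc +_)
             (weighted-∑≡0 (ι v) a flats (m+n≡0⇒m≡0 _ (m+n≡0⇒m≡0 _ rest≡0))))
             (weighted-∑≡0 (ι v) b (zig L) (trans (∑-zig (ι v) L) (m+n≡0⇒n≡0 (∑ (ι v) flats) (m+n≡0⇒m≡0 _ rest≡0)))))
             (weighted-∑≡0 (ι v) (b + N) sorted (trans (∑-sorted (ι v)) (m+n≡0⇒n≡0 _ rest≡0))) ⟩
      vsum v acc + 0 + 0 + 0                                          ≡⟨ eq₀ (vsum v acc) ⟩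
      vsum v acc                                                      ∎
      where
      open ≡-Reasoning
      eq₀ : ∀ x → x + 0 + 0 + 0 ≡ x
      eq₀ = solve-∀
      eq₁ : ∀ a b c d → a + (b + c + d) ≡ a + b + c + d
      eq₁ = solve-∀
      rest≡0 : ∑ (ι v) flats + ∑ (ι v) L + ∑ (ι v) tops ≡ 0
      rest≡0 = +-cancelˡ-≡ (suc (K + K)) _ _ (begin
        suc (K + K) + (∑ (ι v) flats + ∑ (ι v) L + ∑ (ι v) tops) ≡⟨ cong (_+ (∑ (ι v) flats + ∑ (ι v) L + ∑ (ι v) tops)) (sym (full {xs = acc} I.complete l<ρv)) ⟩
        ∑ (ι v) acc + (∑ (ι v) flats + ∑ (ι v) L + ∑ (ι v) tops) ≡⟨ eq₁ (∑ (ι v) acc) _ _ _ ⟩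
        ∑ (ι v) acc + ∑ (ι v) flats + ∑ (ι v) L + ∑ (ι v) tops   ≡⟨ sym (∑-new (ι v)) ⟩
        ∑ (ι v) new                                              ≡⟨ full {xs = new} complete (<⇒≤ l<ρv) ⟩
        suc (K + K)                                              ≡⟨ sym (+-identityʳ _) ⟩
        suc (K + K) + 0 ∎)

    -- Vertices of rank l

    ∑ι-T : ∀ {v} → ρ v ≡ l → ∀ {xs} → All Between xs → ∑ (ι v) xs ≡ ∑ (δ v ∘ tp) xs
    ∑ι-T ρv≡l = ∑-cong-All ∘ All.map (ι-T ρv≡l)

    layer-coeff : ∀ {v} → ρ v ≡ l → ∀ m → 𝟙 (ρ v ≟ l) * m ≡ m
    layer-coeff {v} ρv≡l m = trans (cong (_* m) (𝟙-yes (ρ v ≟ l) ρv≡l)) (*-identityˡ m)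

    tops-at-v : ∀ {v} → ρ v ≡ l → ∑ (ι v) tops ≡ nonempty (upEdges v)
    tops-at-v {v} ρv≡l = begin
      ∑ (ι v) tops                                      ≡⟨ ∑ι-T ρv≡l tops-between ⟩
      ∑ (δ v ∘ tp) tops                                 ≡⟨ D.tops-at v ⟩
      ∑ (λ t → δ v t * nonempty (upEdges t)) (layer l)  ≡⟨ ∑-layer v (nonempty ∘ upEdges) l ⟩
      𝟙 (ρ v ≟ l) * nonempty (upEdges v)                ≡⟨ layer-coeff ρv≡l _ ⟩
      nonempty (upEdges v)                              ∎
      where open ≡-Reasoning

    L-tops-at-v : ∀ {v} → ρ v ≡ l → ∑ (ι v) L + ∑ (ι v) tops ≡ length (upEdges v)
    L-tops-at-v {v} ρv≡l = begin
      ∑ (ι v) L + ∑ (ι v) tops                          ≡⟨ cong₂ _+_ (∑ι-T ρv≡l L-between) (∑ι-T ρv≡l tops-between) ⟩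
      ∑ (δ v ∘ tp) L + ∑ (δ v ∘ tp) tops                ≡⟨ ∑-L-tops (δ v ∘ tp) ⟩
      ∑ (λ t → ∑ (δ v ∘ tp) (upEdges t)) (layer l)      ≡⟨ ∑-cong (∑-upEdges-tp v) (layer l) ⟩
      ∑ (λ t → δ v t * length (upEdges t)) (layer l)    ≡⟨ ∑-layer v (length ∘ upEdges) l ⟩
      𝟙 (ρ v ≟ l) * length (upEdges v)                  ≡⟨ layer-coeff ρv≡l _ ⟩
      length (upEdges v)                                ∎
      where open ≡-Reasoning

    ∑-new-base : ∀ v → ∑ (ι v) new ≡ ∑ (ι v) base + ∑ (ι v) L + ∑ (ι v) tops
    ∑-new-base v = trans (∑-new (ι v)) (cong (λ s → s + ∑ (ι v) L + ∑ (ι v) tops) (sym (∑-++ (ι v) acc flats)))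

    -- Each vertex of the layer is absorbed once and leaves at most one edge in a pair that does not
    -- match at it, or unpaired.
    solo-v : ∀ {v} → ρ v ≡ l → solo (ι v) L ≤ 1
    solo-v {v} ρv≡l = begin
      solo (ι v) L                    ≡⟨ solo-cong (All.map (ι-T ρv≡l) L-between) ⟩
      solo (atT v) L                  ≡⟨ Q.solo-T v ⟩
      gaps (atT v) D.final            ≤⟨ D.gaps-≤ v ⟩
      ∑ (δ v) (layer l)               ≡⟨ ∑-cong (λ t → sym (*-identityʳ (δ v t))) (layer l) ⟩
      ∑ (λ t → δ v t * 1) (layer l)   ≡⟨ ∑-layer v (λ _ → 1) l ⟩
      𝟙 (ρ v ≟ l) * 1                 ≡⟨ *-identityʳ _ ⟩
      𝟙 (ρ v ≟ l)                     ≤⟨ 𝟙≤1 (ρ v ≟ l) ⟩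
      1                               ∎
      where open ≤-Reasoning

    -- K (2 b + N + 1) + length new exceeds (2 K + 1) b, which bounds the sum at a vertex without upper edges.
    upper-level : ∀ v → ρ v ≡ l → vsum v new ≤ K * c′ + length new
    upper-level v ρv≡l = by-cases (upEdges v) refl
      where
      open ≤-Reasoning
      degrees-add : ∑ (ι v) base + ∑ (ι v) L + ∑ (ι v) tops ≡ suc (K + K)
      degrees-add = trans (sym (∑-new-base v)) (full {xs = new} complete (≤-reflexive (sym ρv≡l)))
      by-cases : ∀ es → upEdges v ≡ es → vsum v new ≤ K * c′ + length new
      by-cases [] no-up = begin
        vsum v new                                  ≡⟨ trans (vsum-new′ v) (cong (_+ weight-tops v) (partial-≡ v)) ⟩
        vsum v base + weight-L v + weight-tops v    ≡⟨ cong₂ (λ x y → vsum v base + x + y)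
            (weighted-∑≡0 (ι v) b (zig L) (trans (∑-zig (ι v) L) L≡0))
            (weighted-∑≡0 (ι v) (b + N) sorted (trans (∑-sorted (ι v)) tops≡0)) ⟩
        vsum v base + 0 + 0                         ≡⟨ trans (+-identityʳ _) (+-identityʳ _) ⟩
        vsum v base                                 ≤⟨ weighted-≤ (ι v) 0 base ⟩
        b * ∑ (ι v) base                            ≡⟨ cong (b *_) base≡ ⟩
        b * suc (K + K)                             ≤⟨ m≤m+n _ (K * suc N) ⟩
        b * suc (K + K) + K * suc N                 ≡⟨ eq b K N ⟩
        K * c′ + b                                  ≤⟨ +-monoʳ-≤ (K * c′) b≤new ⟩
        K * c′ + length new                         ∎
        where
        L-tops≡0 : ∑ (ι v) L + ∑ (ι v) tops ≡ 0
        L-tops≡0 = trans (L-tops-at-v ρv≡l) (cong length no-up)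
        L≡0 : ∑ (ι v) L ≡ 0
        L≡0 = m+n≡0⇒m≡0 _ L-tops≡0
        tops≡0 : ∑ (ι v) tops ≡ 0
        tops≡0 = m+n≡0⇒n≡0 (∑ (ι v) L) L-tops≡0
        base≡ : ∑ (ι v) base ≡ suc (K + K)
        base≡ = trans (sym (trans (+-assoc (∑ (ι v) base) _ _) (trans (cong (∑ (ι v) base +_) L-tops≡0) (+-identityʳ _)))) degrees-add
        eq : ∀ b K N → b * suc (K + K) + K * suc N ≡ K * suc (b + b + N) + b
        eq = solve-∀
      -- One edge at `v` is kept back and has label at most `b + N + M`. The other `2 K` edges lie
      -- in `base`, with labels at most `b`, or in the zigzag.
      by-cases (e ∷ es) has-up = begin
        vsum v new                                  ≡⟨ trans (vsum-new′ v) (cong (_+ weight-tops v) (partial-≡ v)) ⟩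
        vsum v base + weight-L v + weight-tops v    ≤⟨ +-mono-≤
            (level-≤ K b N base+L (solo-v ρv≡l) (solo-parity (ι v) L) (weighted-≤ (ι v) 0 base) (zig-≤ (ι v) b L))
            (weighted-≤ (ι v) (b + N) sorted) ⟩
        K * c′ + (b + N + M) * ∑ (ι v) sorted       ≡⟨ cong (λ s → K * c′ + (b + N + M) * s) (trans (∑-sorted (ι v)) tops≡1) ⟩
        K * c′ + (b + N + M) * 1                    ≡⟨ cong (K * c′ +_) (trans (*-identityʳ _) (sym length-new)) ⟩
        K * c′ + length new                         ∎
        where
        tops≡1 : ∑ (ι v) tops ≡ 1
        tops≡1 = trans (tops-at-v ρv≡l) (cong nonempty has-up)
        base+L : ∑ (ι v) base + ∑ (ι v) L ≡ K + K
        base+L = suc-injective (trans (+-comm 1 _) (trans (cong (∑ (ι v) base + ∑ (ι v) L +_) (sym tops≡1)) degrees-add))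

    upper : ∀ v → l ≤ ρ v → vsum v new ≤ K * c′ + length new
    upper v l≤ρv with m≤n⇒m<n∨m≡n l≤ρv
    ... | inj₂ l≡ρv = upper-level v (sym l≡ρv)
    ... | inj₁ l<ρv = begin
      vsum v new          ≡⟨ old l<ρv ⟩
      vsum v acc          ≤⟨ I.upper v l<ρv ⟩
      K * I.c + a         ≤⟨ +-mono-≤ (*-monoʳ-≤ K c≤c′) (≤-trans a≤b b≤new) ⟩
      K * c′ + length new ∎
      where
      open ≤-Reasoning
      c≤c′ : I.c ≤ c′
      c≤c′ = ≤-trans I.c≤ (s≤s (≤-trans (+-mono-≤ a≤b a≤b) (m≤m+n _ N)))

    -- Vertices of rank l − 1

    solo-u : ∀ {u} → suc (ρ u) ≡ l → soloFrom (ι u) 0 L ≤ 1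
    solo-u {u} ρu≡l = ≤-trans (≤-reflexive (soloFrom-cong 0 (All.map (ι-S ρu≡l) L-between))) (Q.solo-S u)

    only-L-tops : ∀ {u} → suc (ρ u) ≡ l → ∑ (ι u) new ≡ ∑ (ι u) L + ∑ (ι u) tops
    only-L-tops {u} ρu≡l = trans (∑-new (ι u)) (cong (λ s → s + ∑ (ι u) L + ∑ (ι u) tops)
      (cong₂ _+_ (absent {xs = acc} I.complete (s≤s (≤-reflexive ρu≡l)))
                 (All⇒∑≡0 (All.map off (all-filter (flat? l) edges)))))
      where
      off : ∀ {e} → Flat l e → ι u e ≡ 0
      off {e} (tp≡ , sp≡) = ι≡0 {u} {e} (λ { refl → 1+n≢n (trans ρu≡l (sym tp≡)) })
                                        (λ { refl → 1+n≢n (trans ρu≡l (sym sp≡)) })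

    has-up⇒top : ∀ {v} → ρ v ≡ l → 0 < length (upEdges v) → ∑ (ι v) tops ≡ 1
    has-up⇒top {v} ρv≡l pos = trans (tops-at-v ρv≡l) (nonempty-1 (upEdges v) pos)
      where
      nonempty-1 : ∀ es → 0 < length es → nonempty es ≡ 1
      nonempty-1 (_ ∷ _) _ = refl

    ∈⇒has-up : ∀ {v e} → e ∈ edges → UpAt v e → 0 < length (upEdges v)
    ∈⇒has-up {v} e∈ up = nonempty-length (∈-filter⁺ (upAt? v) e∈ up)
      where
      nonempty-length : ∀ {e : E} {es} → e ∈ es → 0 < length es
      nonempty-length (here _)  = z<s
      nonempty-length (there _) = z<s

    -- An edge from `u` down to the next layer is not yet in `new`, which contradicts that all
    -- `2 K + 1` edges at `u` are.
    saturated⇒alone : ∀ u → suc (ρ u) ≡ l → ∑ (ι u) new ≡ suc (K + K) → ∀ w → ρ w ≡ ρ u → w ≡ u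
    saturated⇒alone u ρu≡l sat with grounded u
    ... | inj₂ alone = alone
    ... | inj₁ (e , e∈ , refl , up) = contradiction (begin
            1                          ≡⟨ sym (𝟙-yes (¬? (l ≤? ρ (tp e))) (<⇒≱ (≤-reflexive ρu≡l))) ⟩
            low e                      ≡⟨ sym (*-identityʳ (low e)) ⟩
            low e * 1                  ≤⟨ *-monoʳ-≤ (low e) (≤-trans (≤-reflexive (sym (δ-refl (tp e)))) (m≤m+n _ _)) ⟩
            low e * ι u e              ≤⟨ ∑-∈ (λ e → low e * ι u e) e∈ ⟩
            ∑ (λ e → low e * ι u e) edges ≡⟨ low≡0 ⟩
            0 ∎) λ ()
      where
      open ≤-Reasoning
      low high : E → ℕ
      low e  = 𝟙 (¬? (l ≤? ρ (tp e)))
      high e = 𝟙 (l ≤? ρ (tp e))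
      high+low : ∀ {P : Set} (P? : Dec P) m → 𝟙 P? * m + 𝟙 (¬? P?) * m ≡ m
      high+low (yes _) m = trans (+-identityʳ _) (*-identityˡ m)
      high+low (no _)  m = *-identityˡ m
      low≡0 : ∑ (λ e → low e * ι u e) edges ≡ 0
      low≡0 = +-cancelˡ-≡ (suc (K + K)) _ _ (begin-equality
        suc (K + K) + ∑ (λ e → low e * ι u e) edges
          ≡⟨ cong (_+ ∑ (λ e → low e * ι u e) edges) (trans (sym sat) (complete (ι u))) ⟩
        ∑ (λ e → high e * ι u e) edges + ∑ (λ e → low e * ι u e) edges
          ≡⟨ sym (∑-+ _ _ edges) ⟩
        ∑ (λ e → high e * ι u e + low e * ι u e) edges
          ≡⟨ ∑-cong (λ e → high+low (l ≤? ρ (tp e)) (ι u e)) edges ⟩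
        ∑ (ι u) edges    ≡⟨ regular u ⟩
        suc (K + K)      ≡⟨ sym (+-identityʳ _) ⟩
        suc (K + K) + 0  ∎)

    lower : ∀ u r → suc (ρ u) ≡ l → ∑ (ι u) new + r ≡ suc (K + K) →
            K * c′ + length new < vsum u new + r * suc (length new)
    lower u r ρu≡l eq = by-cases r eq
      where
      open ≤-Reasoning
      D T : ℕ
      D = ∑ (ι u) L
      T = ∑ (ι u) tops
      level : ∀ {R} → R + D ≡ K + K → K * suc c′ ≤ weight-L u + R * suc (b + N)
      level R+D = level-≥ K b N R+D (solo-u ρu≡l) (soloFrom-parity (ι u) 0 L) (zig-≥ (ι u) b L)
      L-tops≤ : weight-L u + weight-tops u ≤ vsum u new
      L-tops≤ = begin
        weight-L u + weight-tops u
          ≤⟨ +-monoˡ-≤ (weight-tops u) (m≤n+m (weight-L u) _) ⟩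
        vsum u acc + weight-flats u + weight-L u + weight-tops u
          ≡⟨ sym (vsum-new u) ⟩
        vsum u new ∎
      by-cases : ∀ r → ∑ (ι u) new + r ≡ suc (K + K) →
                 K * c′ + length new < vsum u new + r * suc (length new)
      -- One unlabelled edge is set aside to exceed `length new`. The other `r′`, together with the
      -- kept-back edges at `u`, form the `R` of `level`, since all their labels exceed `b + N`.
      by-cases (suc r′) eq = begin-strict
        K * c′ + length new
          ≤⟨ +-monoˡ-≤ (length new) (*-monoʳ-≤ K (n≤1+n c′)) ⟩
        K * suc c′ + length new
          <⟨ +-mono-≤-< (level {T + r′} degrees-add) (n<1+n (length new)) ⟩
        weight-L u + (T + r′) * suc (b + N) + suc (length new)
          ≡⟨ rearrange (weight-L u) T r′ (suc (b + N)) (suc (length new)) ⟩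
        weight-L u + suc (b + N) * T + r′ * suc (b + N) + suc (length new)
          ≤⟨ +-monoˡ-≤ (suc (length new)) (+-mono-≤ (+-monoʳ-≤ (weight-L u) tops≥)
                                                     (*-monoʳ-≤ r′ (s≤s bN≤new))) ⟩
        weight-L u + weight-tops u + r′ * suc (length new) + suc (length new)
          ≤⟨ +-monoˡ-≤ (suc (length new)) (+-monoˡ-≤ (r′ * suc (length new)) L-tops≤) ⟩
        vsum u new + r′ * suc (length new) + suc (length new)
          ≡⟨ rearrange′ (vsum u new) r′ (suc (length new)) ⟩
        vsum u new + suc r′ * suc (length new) ∎
        where
        tops≥ : suc (b + N) * T ≤ weight-tops u
        tops≥ = ≤-trans (≤-reflexive (cong (suc (b + N) *_) (sym (∑-sorted (ι u)))))
                        (weighted-≥ (ι u) (suc (b + N)) sorted)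
        degrees-add : T + r′ + D ≡ K + K
        degrees-add = suc-injective (trans (rotate T r′ D) (trans (cong (_+ suc r′) (sym (only-L-tops ρu≡l))) eq))
          where
          rotate : ∀ t r d → suc (t + r + d) ≡ d + t + suc r
          rotate = solve-∀
        rearrange : ∀ w t r x y → w + (t + r) * x + y ≡ w + x * t + r * x + y
        rearrange = solve-∀
        rearrange′ : ∀ w r y → w + r * y + y ≡ w + suc r * y
        rearrange′ = solve-∀
      -- Now `u` is alone in its rank, so every kept-back edge ends at `u`. The last of these has
      -- label `length new` and takes the place of the unlabelled edge.
      by-cases zero eq = saturated T refl
        where
        D+T : D + T ≡ suc (K + K)
        D+T = trans (sym (only-L-tops ρu≡l)) (trans (sym (+-identityʳ _)) eq)
        alone : ∀ w → ρ w ≡ ρ u → w ≡ u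
        alone = saturated⇒alone u ρu≡l (trans (sym (+-identityʳ _)) eq)
        at-u : ∀ {e} → Between e → 1 ≤ ι u e
        at-u {e} (_ , sp≡) = ≤-trans
          (≤-reflexive (sym (trans (cong (δ u) (alone (sp e) (suc-injective (trans sp≡ (sym ρu≡l))))) (δ-refl u))))
          (m≤n+m _ (δ u (tp e)))
        T>0 : 0 < T
        T>0 with D in D≡
        ... | zero  = subst (0 <_) (sym (trans (cong (_+ T) (sym D≡)) D+T)) z<s
        -- The upper end of an edge of `L` also has an edge kept back, whose lower end can only be
        -- `u`.
        ... | suc _ with e , e∈L , _ ← ∑-positive (ι u) L (subst (0 <_) (sym D≡) z<s)
          with tp≡ , _ ← All.lookup L-between e∈L
          with e′ , e′∈tops , _ ← ∑-positive (ι (tp e)) tops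
                 (≤-reflexive (sym (has-up⇒top tp≡ (begin
                   1                                     ≡⟨ sym (δ-refl (tp e)) ⟩
                   δ (tp e) (tp e)                       ≤⟨ m≤m+n _ _ ⟩
                   ι (tp e) e                            ≤⟨ ∑-∈ (ι (tp e)) e∈L ⟩
                   ∑ (ι (tp e)) L                        ≤⟨ m≤m+n _ _ ⟩
                   ∑ (ι (tp e)) L + ∑ (ι (tp e)) tops    ≡⟨ L-tops-at-v tp≡ ⟩
                   length (upEdges (tp e))               ∎))))
          = ≤-trans (at-u (All.lookup tops-between e′∈tops)) (∑-∈ (ι u) e′∈tops)
        saturated : ∀ t → T ≡ t → K * c′ + length new < vsum u new + 0 * suc (length new)
        saturated zero     T≡ = contradiction (subst (0 <_) T≡ T>0) λ ()
        saturated (suc t′) T≡ = begin-strict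
          K * c′ + length new
            -- No edge at `u` gets a label above `length new`, so the strictness has to come from
            -- `K > 0` and the gain of one between `c′` and `suc c′`.
            <⟨ +-monoˡ-< (length new) (≤-trans (+-monoˡ-≤ (K * c′) 0<K) (≤-reflexive (sym (*-suc K c′)))) ⟩
          K * suc c′ + length new
            ≤⟨ +-monoˡ-≤ (length new) (level {t′} degrees-add) ⟩
          weight-L u + t′ * suc (b + N) + length new
            ≡⟨ +-assoc (weight-L u) _ _ ⟩
          weight-L u + (t′ * suc (b + N) + length new)
            ≤⟨ +-monoʳ-≤ (weight-L u) tops≥ ⟩
          weight-L u + weight-tops u
            ≤⟨ L-tops≤ ⟩
          vsum u new
            ≡⟨ sym (+-identityʳ _) ⟩
          vsum u new + 0 * suc (length new) ∎
          where
          degrees-add : t′ + D ≡ K + K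
          degrees-add = suc-injective (trans (cong (_+ D) (sym T≡)) (trans (+-comm T D) D+T))
          rearrange : ∀ t x m → suc (t * suc x + (x + m)) ≡ suc x * suc t + m
          rearrange = solve-∀
          tops≥ : t′ * suc (b + N) + length new ≤ weight-tops u
          tops≥ = s≤s⁻¹ (begin
            suc (t′ * suc (b + N) + length new)       ≡⟨ cong (λ m → suc (t′ * suc (b + N) + m)) length-new ⟩
            suc (t′ * suc (b + N) + (b + N + M))      ≡⟨ rearrange t′ (b + N) M ⟩
            suc (b + N) * suc t′ + M                  ≡⟨ cong (λ s → suc (b + N) * s + M) (trans (sym T≡) (sym (∑-sorted (ι u)))) ⟩
            suc (b + N) * ∑ (ι u) sorted + M          ≤⟨ weighted-≥-last (ι u) (b + N) sorted (All.map at-u sorted-between) ⟩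
            suc (weight-tops u)                       ∎)

    -- The edges at `u` outside `acc` all get labels above `length acc`, as `I.lower` assumes, while
    -- the sum at `v` no longer changes.
    below-< : ∀ {u v} → ρ u ≡ l → suc l ≤ ρ v → vsum v new < vsum u new
    below-< {u} {v} ρu≡l l<ρv = begin-strict
      vsum v new                        ≡⟨ old l<ρv ⟩
      vsum v acc                        ≤⟨ I.upper v l<ρv ⟩
      K * I.c + a                       <⟨ I.lower u r (cong suc ρu≡l) degrees-add ⟩
      vsum u acc + r * suc a            ≡⟨ eq₁ (vsum u acc) (∑ (ι u) flats) (∑ (ι u) L) (∑ (ι u) tops) a ⟩
      vsum u acc + suc a * ∑ (ι u) flats + suc a * ∑ (ι u) L + suc a * ∑ (ι u) tops
        ≤⟨ +-mono-≤ (+-mono-≤ (+-monoʳ-≤ (vsum u acc) (weighted-≥ (ι u) (suc a) flats)) L≥) tops≥ ⟩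
      vsum u acc + weight-flats u + weight-L u + weight-tops u
        ≡⟨ sym (vsum-new u) ⟩
      vsum u new ∎
      where
      open ≤-Reasoning
      r : ℕ
      r = ∑ (ι u) flats + ∑ (ι u) L + ∑ (ι u) tops
      eq₁ : ∀ x f m t a → x + (f + m + t) * suc a ≡ x + suc a * f + suc a * m + suc a * t
      eq₁ = solve-∀
      eq₂ : ∀ x f m t → x + (f + m + t) ≡ x + f + m + t
      eq₂ = solve-∀
      degrees-add : ∑ (ι u) acc + r ≡ suc (K + K)
      degrees-add = trans (eq₂ (∑ (ι u) acc) _ _ _)
        (trans (sym (∑-new (ι u))) (full {xs = new} complete (≤-reflexive (sym ρu≡l))))
      L≥ : suc a * ∑ (ι u) L ≤ weight-L u
      L≥ = begin
        suc a * ∑ (ι u) L          ≤⟨ *-monoˡ-≤ (∑ (ι u) L) (s≤s a≤b) ⟩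
        suc b * ∑ (ι u) L          ≡⟨ cong (suc b *_) (sym (∑-zig (ι u) L)) ⟩
        suc b * ∑ (ι u) (zig L)    ≤⟨ weighted-≥ (ι u) (suc b) (zig L) ⟩
        weight-L u                 ∎
      tops≥ : suc a * ∑ (ι u) tops ≤ weight-tops u
      tops≥ = begin
        suc a * ∑ (ι u) tops            ≤⟨ *-monoˡ-≤ (∑ (ι u) tops) (s≤s (≤-trans a≤b (m≤m+n b N))) ⟩
        suc (b + N) * ∑ (ι u) tops      ≡⟨ cong (suc (b + N) *_) (sym (∑-sorted (ι u))) ⟩
        suc (b + N) * ∑ (ι u) sorted    ≤⟨ weighted-≥ (ι u) (suc (b + N)) sorted ⟩
        weight-tops u                   ∎

    -- Neither of two different vertices of rank `l` is alone in it, so by `grounded` each has an up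
    -- edge and hence exactly one entry in `sorted`.
    level-distinct : ∀ {u v} → ρ u ≡ l → ρ v ≡ l → u ≢ v → vsum u new ≢ vsum v new
    level-distinct {u} {v} ρu≡l ρv≡l u≢v sums≡ =
      sorted-distinct partial tp (b + N) sorted (Sorted⇒AllPairs (DecTotalOrder.totalOrder byPartial) (sort-↗ tops)) u≢v
        (once ρu≡l (grounded′ ρv≡l ρu≡l (u≢v ∘ sym))) (once ρv≡l (grounded′ ρu≡l ρv≡l u≢v))
        (trans (sym (as-tp ρu≡l)) (trans sums≡ (as-tp ρv≡l)))
      where
      as-tp : ∀ {v} → ρ v ≡ l → vsum v new ≡ partial v + weighted (δ v ∘ tp) (suc (b + N)) sorted
      as-tp {v} ρv≡l = trans (vsum-new′ v)
        (cong (partial v +_) (weighted-cong (suc (b + N)) (All.map (ι-T ρv≡l) sorted-between)))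
      grounded′ : ∀ {u v} → ρ u ≡ l → ρ v ≡ l → u ≢ v → 0 < length (upEdges v)
      grounded′ {u} {v} ρu≡l ρv≡l u≢v with grounded v
      ... | inj₁ (e , e∈ , up) = ∈⇒has-up e∈ up
      ... | inj₂ alone         = contradiction (alone u (trans ρu≡l (sym ρv≡l))) u≢v
      once : ∀ {v} → ρ v ≡ l → 0 < length (upEdges v) → ∑ (δ v ∘ tp) sorted ≡ 1
      once {v} ρv≡l pos = trans (∑-sorted (δ v ∘ tp))
        (trans (sym (∑ι-T ρv≡l tops-between)) (has-up⇒top ρv≡l pos))

    distinct : ∀ {u v} → l ≤ ρ u → l ≤ ρ v → u ≢ v → vsum u new ≢ vsum v new
    distinct l≤ρu l≤ρv u≢v with m≤n⇒m<n∨m≡n l≤ρu | m≤n⇒m<n∨m≡n l≤ρv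
    ... | inj₁ l<ρu | inj₁ l<ρv = λ sums≡ →
      I.distinct l<ρu l<ρv u≢v (trans (sym (old l<ρu)) (trans sums≡ (old l<ρv)))
    ... | inj₁ l<ρu | inj₂ l≡ρv = <⇒≢ (below-< (sym l≡ρv) l<ρu)
    ... | inj₂ l≡ρu | inj₁ l<ρv = >⇒≢ (below-< (sym l≡ρu) l<ρv)
    ... | inj₂ l≡ρu | inj₂ l≡ρv = level-distinct (sym l≡ρu) (sym l≡ρv) u≢v

    next : Invariant l new
    next = record
      { complete = complete
      ; c        = c′
      ; c≤       = s≤s (≤-trans (≤-reflexive (+-assoc b b N)) (+-mono-≤ b≤new bN≤new))
      ; upper    = upper
      ; lower    = lower
      ; distinct = distinct
      }

  initial : ∀ {l} → (∀ v → ρ v < l) → Invariant l []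
  initial {l} ρ<l = record
    { complete = λ g → sym (All⇒∑≡0 {xs = edges} (All.tabulate λ {e} _ →
                   cong (_* g e) (𝟙-no (l ≤? ρ (tp e)) (<⇒≱ (ρ<l (tp e))))))
    ; c        = 0
    ; c≤       = z≤n
    ; upper    = λ v l≤ρv → contradiction l≤ρv (<⇒≱ (ρ<l v))
    -- Nothing is labelled yet, so `r` is the full degree `2 K + 1`, which is positive.
    ; lower    = λ { u r _ refl → ≤-trans (s≤s (≤-reflexive (trans (+-identityʳ _) (*-zeroʳ K)))) z<s }
    ; distinct = λ {u} l≤ρu → contradiction l≤ρu (<⇒≱ (ρ<l u))
    }

  build : ∀ l acc → Invariant l acc → ∃ (Invariant 0)
  build zero    acc I = acc , I
  build (suc l) acc I = build l (Step.new l acc I) (Step.next l acc I)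

  ordering : ∀ {l} → (∀ v → ρ v < l) →
    ∃ λ order → (∀ g → ∑ g order ≡ ∑ g edges) × (∀ {u v} → u ≢ v → vsum u order ≢ vsum v order)
  ordering {l} ρ<l =
    let order , I = build l [] (initial ρ<l) in
    order ,
    (λ g → trans (Invariant.complete I g) (∑-cong (λ e → *-identityˡ (g e)) edges)) ,
    Invariant.distinct I z≤n z≤n

-- Lists without repetition, and positions as labels.

unique⇒lookup-injective : {xs : List A} → Unique xs → ∀ {i j} → lookup xs i ≡ lookup xs j → i ≡ j
unique⇒lookup-injective (_ ∷ _)    {zero}  {zero}  _  = refl
unique⇒lookup-injective (x≢xs ∷ _) {zero}  {suc j} eq = contradiction eq (All.lookup x≢xs (∈-lookup j))
unique⇒lookup-injective (x≢xs ∷ _) {suc i} {zero}  eq = contradiction (sym eq) (All.lookup x≢xs (∈-lookup i))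
unique⇒lookup-injective (_ ∷ u)    {suc i} {suc j} eq = cong suc (unique⇒lookup-injective u eq)

∑-weighted : (h lab : A → ℕ) → ∀ a xs → (∀ i → lab (lookup xs i) ≡ a + toℕ i) →
             ∑ (λ x → h x * lab x) xs ≡ weighted h a xs
∑-weighted h lab a []       _  = refl
∑-weighted h lab a (x ∷ xs) eq = cong₂ _+_
  (trans (*-comm (h x) (lab x)) (cong (_* h x) (trans (eq zero) (+-identityʳ a))))
  (∑-weighted h lab (suc a) xs (λ i → trans (eq (suc i)) (+-suc a (toℕ i))))

count≤1⇒unique : (_≟ᴬ_ : DecidableEquality A) → ∀ xs → (∀ x → ∑ (λ y → 𝟙 (x ≟ᴬ y)) xs ≤ 1) → Unique xs
count≤1⇒unique _≟ᴬ_ []       _  = []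
count≤1⇒unique _≟ᴬ_ (x ∷ xs) ≤1 =
  All.map (λ {y} 𝟙≡0 x≡y → contradiction (trans (sym (𝟙-yes (x ≟ᴬ y) x≡y)) 𝟙≡0) λ ())
    (∑≡0⇒All (λ y → 𝟙 (x ≟ᴬ y)) xs
      (n≤0⇒n≡0 (s≤s⁻¹ (≤-trans (≤-reflexive (cong (_+ ∑ (λ y → 𝟙 (x ≟ᴬ y)) xs) (sym (𝟙-yes (x ≟ᴬ x) refl)))) (≤1 x)))))
  ∷ count≤1⇒unique _≟ᴬ_ xs (λ z → ≤-trans (m≤n+m _ (𝟙 (z ≟ᴬ x))) (≤1 z))

AllPairs-unique : {P : A → Set} {R : A → A → Set} → (∀ {x y} → P x → P y → x ≢ y → R x y) →
                  ∀ {xs} → All P xs → Unique xs → AllPairs R xs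
AllPairs-unique r []       []       = []
AllPairs-unique r (p ∷ ps) (≢s ∷ u) =
  All.zipWith (λ (q , x≢y) → r p q x≢y) (ps , ≢s) ∷ AllPairs-unique r ps u

∑-mono-< : {g h : A → ℕ} → (∀ x → g x ≤ h x) → ∀ {x xs} → x ∈ xs → g x < h x → ∑ g xs < ∑ h xs
∑-mono-< g≤h {xs = _ ∷ xs} (here refl)  gx<hx = +-mono-<-≤ gx<hx (∑-mono g≤h xs)
∑-mono-< g≤h               (there x∈xs) gx<hx = +-mono-≤-< (g≤h _) (∑-mono-< g≤h x∈xs gx<hx)

choose : {P : Set} → Dec P → A → A → A
choose (yes _) x y = x
choose (no _)  x y = y

odd⇒1+double : ∀ k → parity k ≡ 1ℙ → ∃ λ K → k ≡ suc (K + K)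
odd⇒1+double (suc zero)    _   = 0 , refl
odd⇒1+double (suc (suc k)) odd =
  let K , eq = odd⇒1+double k odd in suc K , trans (cong (2 +_) eq) (cong (2 +_) (sym (+-suc K K)))

-- Breadth-first ranking of the vertices.

module _ {n : ℕ} (G : Graph n) where

  open Graph G

  -- Distances from a root in each component, with the components stacked so that
  -- a root is alone in its rank.
  record Ranking : Set where
    field
      ρ        : Fin n → ℕ
      height   : ℕ
      ρ<height : ∀ v → ρ v < height
      step     : ∀ {u v} → u ~ v → ρ u ≤ suc (ρ v)
      grounded : ∀ v → (∃ λ u → u ~ v × suc (ρ u) ≡ ρ v) ⊎ (∀ u → ρ u ≡ ρ v → u ≡ v)

  -- The vertices of rank j are those not yet reached.
  record PartialRanking (j : ℕ) : Set where
    field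
      ρ        : Fin n → ℕ
      ρ≤j      : ∀ v → ρ v ≤ j
      step     : ∀ {u v} → u ~ v → ρ u ≤ suc (ρ v)
      grounded : ∀ v → ρ v < j → (∃ λ u → u ~ v × suc (ρ u) ≡ ρ v) ⊎ (∀ u → ρ u ≡ ρ v → u ≡ v)

    unreached : ℕ
    unreached = ∑ (λ v → 𝟙 (ρ v ≟ j)) (allFin n)

  open PartialRanking using (unreached)

  module _ {j : ℕ} (R : PartialRanking j) where

    private module R = PartialRanking R

    -- The kept vertices get `j` as their final rank and the other unreached ones move on to
    -- `j + 1`. This respects `step` because no moved vertex has a neighbour of rank `j − 1`, and
    -- `x` witnesses that fewer vertices remain.
    bump : {Keep : Fin n → Set} (keep? : Unary.Decidable Keep) →
           ∀ {x} → R.ρ x ≡ j → Keep x →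
           (∀ {u v} → R.ρ u ≡ j → ¬ Keep u → u ~ v → suc (R.ρ v) ≢ j) →
           (∀ v → R.ρ v ≡ j → Keep v →
             (∃ λ u → u ~ v × suc (R.ρ u) ≡ j) ⊎ (∀ u → R.ρ u ≡ j → Keep u → u ≡ v)) →
           ∃ λ (R′ : PartialRanking (suc j)) → unreached R′ < R.unreached
    bump {Keep} keep? {x} ρx≡j keep-x kept-away kept-grounded = R′ , fewer
      where
      Moved : Fin n → Set
      Moved v = R.ρ v ≡ j × ¬ Keep v

      moved? : Unary.Decidable Moved
      moved? v = (R.ρ v ≟ j) ×-dec ¬? (keep? v)

      ρ′ : Fin n → ℕ
      ρ′ v = R.ρ v + 𝟙 (moved? v)

      ρ≤ρ′ : ∀ v → R.ρ v ≤ ρ′ v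
      ρ≤ρ′ v = m≤m+n _ _

      ρ′-moved : ∀ {v} → Moved v → ρ′ v ≡ suc j
      ρ′-moved {v} m = trans (cong₂ _+_ (proj₁ m) (𝟙-yes (moved? v) m)) (+-comm j 1)

      ρ′-fixed : ∀ {v} → ¬ Moved v → ρ′ v ≡ R.ρ v
      ρ′-fixed {v} ¬m = trans (cong (R.ρ v +_) (𝟙-no (moved? v) ¬m)) (+-identityʳ _)

      below : ∀ {v} → R.ρ v < j → ρ′ v ≡ R.ρ v
      below ρv<j = ρ′-fixed (λ m → <⇒≢ ρv<j (proj₁ m))

      ρ′<⇒fixed : ∀ {v} → ρ′ v < suc j → ¬ Moved v
      ρ′<⇒fixed ρ′v< m = <⇒≢ ρ′v< (ρ′-moved m)

      kept : ∀ {v} → R.ρ v ≡ j → ¬ Moved v → Keep v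
      kept {v} ρv≡j ¬m = decidable-stable (keep? v) (λ ¬k → ¬m (ρv≡j , ¬k))

      ρ′≤ : ∀ v → ρ′ v ≤ suc j
      ρ′≤ v = ≤-trans (+-mono-≤ (R.ρ≤j v) (𝟙≤1 (moved? v))) (≤-reflexive (+-comm j 1))

      step′ : ∀ {u v} → u ~ v → ρ′ u ≤ suc (ρ′ v)
      step′ {u} {v} u~v = by-cases (moved? u)
        where
        open ≤-Reasoning
        by-cases : Dec (Moved u) → ρ′ u ≤ suc (ρ′ v)
        by-cases (no ¬m) = begin
          ρ′ u         ≡⟨ ρ′-fixed ¬m ⟩
          R.ρ u        ≤⟨ R.step u~v ⟩
          suc (R.ρ v)  ≤⟨ s≤s (ρ≤ρ′ v) ⟩
          suc (ρ′ v)   ∎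
        by-cases (yes m) = begin
          ρ′ u         ≡⟨ ρ′-moved m ⟩
          suc j        ≤⟨ ≤∧≢⇒< j≤ (λ eq → kept-away (proj₁ m) (proj₂ m) u~v (sym eq)) ⟩
          suc (R.ρ v)  ≤⟨ s≤s (ρ≤ρ′ v) ⟩
          suc (ρ′ v)   ∎
          where
          j≤ : j ≤ suc (R.ρ v)
          j≤ = subst (_≤ suc (R.ρ v)) (proj₁ m) (R.step u~v)

      grounded′ : ∀ v → ρ′ v < suc j →
                  (∃ λ u → u ~ v × suc (ρ′ u) ≡ ρ′ v) ⊎ (∀ u → ρ′ u ≡ ρ′ v → u ≡ v)
      grounded′ v ρ′v< = by-cases (m≤n⇒m<n∨m≡n (R.ρ≤j v))
        where
        ¬m : ¬ Moved v
        ¬m = ρ′<⇒fixed ρ′v<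
        fix-v : ρ′ v ≡ R.ρ v
        fix-v = ρ′-fixed ¬m
        lift : (∃ λ u → u ~ v × suc (R.ρ u) ≡ R.ρ v) → ∃ λ u → u ~ v × suc (ρ′ u) ≡ ρ′ v
        lift (u , u~v , eq) = u , u~v ,
          trans (cong suc (below (≤-trans (≤-reflexive eq) (R.ρ≤j v)))) (trans eq (sym fix-v))
        same : ∀ {u} → ρ′ u ≡ ρ′ v → ¬ Moved u × R.ρ u ≡ R.ρ v
        same {u} eq = ¬mu , trans (sym (ρ′-fixed ¬mu)) (trans eq fix-v)
          where
          ¬mu : ¬ Moved u
          ¬mu = ρ′<⇒fixed (subst (_< suc j) (sym eq) ρ′v<)
        by-cases : R.ρ v < j ⊎ R.ρ v ≡ j →
                   (∃ λ u → u ~ v × suc (ρ′ u) ≡ ρ′ v) ⊎ (∀ u → ρ′ u ≡ ρ′ v → u ≡ v)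
        by-cases (inj₁ ρv<j) with R.grounded v ρv<j
        ... | inj₁ nbr   = inj₁ (lift nbr)
        ... | inj₂ alone = inj₂ (λ u eq → alone u (proj₂ (same eq)))
        by-cases (inj₂ ρv≡j) with kept-grounded v ρv≡j (kept ρv≡j ¬m)
        ... | inj₁ (u , u~v , eq) = inj₁ (lift (u , u~v , trans eq (sym ρv≡j)))
        ... | inj₂ alone = inj₂ (λ u eq → let ρu≡j = trans (proj₂ (same eq)) ρv≡j in
                                          alone u ρu≡j (kept ρu≡j (proj₁ (same eq))))

      R′ : PartialRanking (suc j)
      R′ = record { ρ = ρ′ ; ρ≤j = ρ′≤ ; step = step′ ; grounded = grounded′ }

      fewer : unreached R′ < R.unreached
      fewer = ∑-mono-< pointwise (∈-allFin x) (subst₂ _<_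
          (sym (𝟙-no (ρ′ x ≟ suc j) (λ eq → <⇒≢ (s≤s (R.ρ≤j x)) (trans (sym (ρ′-fixed x-fixed)) eq))))
          (sym (𝟙-yes (R.ρ x ≟ j) ρx≡j)) z<s)
        where
        x-fixed : ¬ Moved x
        x-fixed (_ , ¬k) = ¬k keep-x
        pointwise : ∀ v → 𝟙 (ρ′ v ≟ suc j) ≤ 𝟙 (R.ρ v ≟ j)
        pointwise v with ρ′ v ≟ suc j
        ... | no _   = z≤n
        ... | yes eq = ≤-reflexive (sym (𝟙-yes (R.ρ v ≟ j) (proj₁ (decidable-stable (moved? v)
                         (λ ¬m → <⇒≢ (s≤s (R.ρ≤j v)) (trans (sym (ρ′-fixed ¬m)) eq))))))

    frontier? : ∀ v → Dec (∃ λ u → u ~ v × suc (R.ρ u) ≡ j)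
    frontier? v = Fin.any? (λ u → (u ~? v) ×-dec (suc (R.ρ u) ≟ j))

    advance : ∀ {x} → R.ρ x ≡ j → ∃ λ (R′ : PartialRanking (suc j)) → unreached R′ < R.unreached
    advance {x} ρx≡j with Fin.any? (λ v → (R.ρ v ≟ j) ×-dec frontier? v)
    -- The search continues: all unreached neighbours of rank `j − 1` are kept.
    ... | yes (y , ρy≡j , frontier-y) = bump frontier? ρy≡j frontier-y
            (λ {u} {v} _ ¬f u~v eq → ¬f (v , ~-sym u~v , eq)) (λ v _ f → inj₁ f)
    -- No unreached vertex touches rank `j − 1`, so `x` alone is kept, as the root of a new
    -- component.
    ... | no none = bump (Fin._≟ x) ρx≡j refl
            (λ {u} {v} ρu≡j _ u~v eq → none (u , ρu≡j , v , ~-sym u~v , eq))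
            (λ { v _ refl → inj₂ (λ _ _ u≡x → u≡x) })

  -- The bound `m` on the number of unreached vertices makes the recursion structural.
  complete : ∀ {j} m (R : PartialRanking j) → unreached R ≤ m → Ranking
  complete {j} m R un≤m with Fin.any? (λ v → PartialRanking.ρ R v ≟ j)
  complete {j} m R un≤m | no none = record
    { ρ = ρ ; height = j ; ρ<height = <j ; step = step ; grounded = λ v → grounded v (<j v) }
    where
    open PartialRanking R
    <j : ∀ v → ρ v < j
    <j v = ≤∧≢⇒< (ρ≤j v) (λ eq → none (v , eq))
  complete zero R un≤0 | yes (x , ρx≡j) with R′ , fewer ← advance R ρx≡j =
    contradiction (<-≤-trans fewer un≤0) λ ()
  complete (suc m) R un≤m | yes (x , ρx≡j) with R′ , fewer ← advance R ρx≡j =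
    complete m R′ (s≤s⁻¹ (<-≤-trans fewer un≤m))

  ranking : Ranking
  -- At `j = 0` every vertex is still unreached.
  ranking = complete {0} _ (record { ρ = λ _ → 0 ; ρ≤j = λ _ → z≤n ; step = λ _ → z≤n ; grounded = λ _ () }) ≤-refl

  -- Edges and incidences.

  open Edge using (low; high)

  low<high : (e : Edge G) → low e <ᶠ high e
  low<high (edge u v u<v _) = recompute (u Fin.<? v) u<v

  low~high : (e : Edge G) → low e ~ high e
  low~high (edge u v _ u~v) = recompute (u ~? v) u~v

  edge-≡ : {e e′ : Edge G} → low e ≡ low e′ → high e ≡ high e′ → e ≡ e′
  edge-≡ refl refl = refl

  _≟ᴱ_ : DecidableEquality (Edge G)
  e ≟ᴱ e′ with low e Fin.≟ low e′ | high e Fin.≟ high e′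
  ... | yes p | yes q = yes (edge-≡ p q)
  ... | yes _ | no ¬q = no (¬q ∘ cong high)
  ... | no ¬p | _     = no (¬p ∘ cong low)

  incidence : Fin n → Edge G → ℕ
  incidence v e = δ v (low e) + δ v (high e)

  𝟙-incident : ∀ v e → 𝟙 (incident? G v e) ≡ incidence v e
  𝟙-incident v e with v Fin.≟ low e | v Fin.≟ high e
  ... | yes refl | yes v≡high = contradiction v≡high (Fin.<⇒≢ (low<high e))
  ... | yes _    | no _       = refl
  ... | no _     | yes _      = refl
  ... | no _     | no _       = refl

  ∑-incident : ∀ v g → ∑ g (incidentEdges G v) ≡ ∑ (λ e → incidence v e * g e) (edges G)
  ∑-incident v g = trans (∑-filter (incident? G v) g (edges G))
                         (∑-cong (λ e → cong (_* g e) (𝟙-incident v e)) (edges G))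

  -- The labeling given by an ordering of the edges.

  module Labelling (order : List (Edge G)) (same-∑ : ∀ g → ∑ g order ≡ ∑ g (edges G)) where

    -- This is `same-∑` for the indicator of `e`; it makes `order` a list of every edge exactly
    -- once.
    count≡1 : ∀ e → ∑ (λ e′ → 𝟙 (e ≟ᴱ e′)) order ≡ 1
    count≡1 e = begin
      ∑ (λ e′ → 𝟙 (e ≟ᴱ e′)) order          ≡⟨ same-∑ _ ⟩
      ∑ (λ e′ → 𝟙 (e ≟ᴱ e′)) (edges G)      ≡⟨ ∑-cong (λ e′ → sym (*-identityʳ _)) (edges G) ⟩
      ∑ (λ e′ → 𝟙 (e ≟ᴱ e′) * 1) (edges G)  ≡⟨ ∑-indicator _≟ᴱ_ (λ _ → 1) (edges-unique G) (∈-edges G e) ⟩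
      1                                     ∎
      where open ≡-Reasoning

    ∈-order : ∀ e → e ∈ order
    ∈-order e with e′ , e′∈ , pos ← ∑-positive (λ e′ → 𝟙 (e ≟ᴱ e′)) order (≤-reflexive (sym (count≡1 e)))
      = subst (_∈ order) (sym (𝟙-positive (e ≟ᴱ e′) pos)) e′∈

    order-unique : Unique order
    order-unique = count≤1⇒unique _≟ᴱ_ order (λ e → ≤-reflexive (count≡1 e))

    length≡ : length order ≡ edgeCount G
    length≡ = trans (sym (∑-1 order)) (trans (same-∑ (λ _ → 1)) (∑-1 (edges G)))

    index-lookup : ∀ i → index (∈-order (lookup order i)) ≡ i
    index-lookup i = unique⇒lookup-injective order-unique (sym (lookup-index (∈-order (lookup order i))))

    labeling : Labeling G
    labeling = ↔⇒⤖ (mk↔ₛ′ (λ e → cast length≡ (index (∈-order e)))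
      (λ i → lookup order (cast (sym length≡) i))
      (λ i → trans (cong (cast length≡) (index-lookup _)) (Fin.cast-involutive length≡ (sym length≡) i))
      (λ e → trans (cong (lookup order) (Fin.cast-involutive (sym length≡) length≡ _))
                   (sym (lookup-index (∈-order e)))))

    label-lookup : ∀ i → label G labeling (lookup order i) ≡ 1 + toℕ i
    label-lookup i = cong suc (trans (Fin.toℕ-cast length≡ _) (cong toℕ (index-lookup i)))

    vertexSum-≡ : ∀ v → vertexSum G labeling v ≡ weighted (incidence v) 1 order
    vertexSum-≡ v = begin
      vertexSum G labeling v                                        ≡⟨ ∑-incident v (label G labeling) ⟩
      ∑ (λ e → incidence v e * label G labeling e) (edges G)        ≡⟨ sym (same-∑ _) ⟩
      ∑ (λ e → incidence v e * label G labeling e) order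
        ≡⟨ ∑-weighted (incidence v) (label G labeling) 1 order label-lookup ⟩
      weighted (incidence v) 1 order                                ∎
      where open ≡-Reasoning

  -- Orientation of the edges by rank.

  module Orientation (ρ : Fin n → ℕ) (step : ∀ {u v} → u ~ v → ρ u ≤ suc (ρ v)) where

    -- For ends of equal rank the choice of the upper end is arbitrary.
    tp sp : Edge G → Fin n
    tp e = choose (ρ (low e) ≤? ρ (high e)) (high e) (low e)
    sp e = choose (ρ (low e) ≤? ρ (high e)) (low e) (high e)

    orient : ∀ e → (tp e ≡ high e × sp e ≡ low e × ρ (low e) ≤ ρ (high e)) ⊎
                   (tp e ≡ low e × sp e ≡ high e × ρ (high e) < ρ (low e))
    orient e with ρ (low e) ≤? ρ (high e)
    ... | yes le = inj₁ (refl , refl , le)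
    ... | no  ≰  = inj₂ (refl , refl , ≰⇒> ≰)

    adjacent : ∀ e → tp e ~ sp e
    adjacent e with orient e
    ... | inj₁ (t , s , _) = subst₂ _~_ (sym t) (sym s) (~-sym (low~high e))
    ... | inj₂ (t , s , _) = subst₂ _~_ (sym t) (sym s) (low~high e)

    sp≤tp : ∀ e → ρ (sp e) ≤ ρ (tp e)
    sp≤tp e with orient e
    ... | inj₁ (t , s , le) = subst₂ (λ x y → ρ x ≤ ρ y) (sym s) (sym t) le
    ... | inj₂ (t , s , lt) = subst₂ (λ x y → ρ x ≤ ρ y) (sym s) (sym t) (<⇒≤ lt)

    rank : ∀ e → ρ (tp e) ≡ ρ (sp e) ⊎ ρ (tp e) ≡ suc (ρ (sp e))
    rank e with m≤n⇒m<n∨m≡n (step (adjacent e))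
    ... | inj₁ lt = inj₁ (≤-antisym (s≤s⁻¹ lt) (sp≤tp e))
    ... | inj₂ eq = inj₂ eq

    incidence-≡ : ∀ v e → δ v (tp e) + δ v (sp e) ≡ incidence v e
    incidence-≡ v e with orient e
    ... | inj₁ (t , s , _) = trans (cong₂ _+_ (cong (δ v) t) (cong (δ v) s)) (+-comm (δ v (high e)) _)
    ... | inj₂ (t , s , _) = cong₂ _+_ (cong (δ v) t) (cong (δ v) s)

    -- If the two edges were oriented differently, the same two vertices would be ordered both ways
    -- by `low<high`.
    determined : ∀ {e e′} → tp e ≡ tp e′ → sp e ≡ sp e′ → e ≡ e′
    determined {e} {e′} t≡ s≡ with orient e | orient e′
    ... | inj₁ (t , s , _) | inj₁ (t′ , s′ , _) =
      edge-≡ (trans (sym s) (trans s≡ s′)) (trans (sym t) (trans t≡ t′))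
    ... | inj₂ (t , s , _) | inj₂ (t′ , s′ , _) =
      edge-≡ (trans (sym t) (trans t≡ t′)) (trans (sym s) (trans s≡ s′))
    ... | inj₁ (t , s , _) | inj₂ (t′ , s′ , _) = contradiction (low<high e)
      (Fin.<-asym (subst₂ _<ᶠ_ (trans (sym t′) (trans (sym t≡) t)) (trans (sym s′) (trans (sym s≡) s)) (low<high e′)))
    ... | inj₂ (t , s , _) | inj₁ (t′ , s′ , _) = contradiction (low<high e)
      (Fin.<-asym (subst₂ _<ᶠ_ (trans (sym s′) (trans (sym s≡) s)) (trans (sym t′) (trans (sym t≡) t)) (low<high e′)))

    open Layers tp sp (edges G) ρ using (UpAt; upAt?; upEdges)

    simple : ∀ t → AllPairs (λ e e′ → sp e ≢ sp e′) (upEdges t)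
    simple t = AllPairs-unique (λ (tp≡ , _) (tp′≡ , _) e≢e′ sp≡ → e≢e′ (determined (trans tp≡ (sym tp′≡)) sp≡))
      (all-filter (upAt? t) (edges G)) (unique-filter⁺ (upAt? t) (edges-unique G))

    edgeTo : ∀ {u v} → u ~ v → suc (ρ u) ≡ ρ v → ∃ λ e → e ∈ edges G × UpAt v e
    edgeTo {u} {v} u~v eq with Fin.<-cmp u v
    ... | tri≈ _ u≡v _ = contradiction u~v (~-irrefl u≡v)
    ... | tri< u<v _ _ = e , ∈-edges G e , at-v
      where
      e : Edge G
      e = edge u v u<v u~v
      at-v : UpAt v e
      at-v with orient e
      ... | inj₁ (t , s , _)  = t , trans (cong ρ t) (trans (sym eq) (cong (suc ∘ ρ) (sym s)))
      ... | inj₂ (_ , _ , lt) = contradiction (≤-trans (n≤1+n _) (≤-reflexive eq)) (<⇒≱ lt)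
    ... | tri> _ _ v<u = e , ∈-edges G e , at-v
      where
      e : Edge G
      e = edge v u v<u (~-sym u~v)
      at-v : UpAt v e
      at-v with orient e
      ... | inj₁ (_ , _ , le) = contradiction le (<⇒≱ (≤-reflexive eq))
      ... | inj₂ (t , s , _)  = t , trans (cong ρ t) (trans (sym eq) (cong (suc ∘ ρ) (sym s)))

  -- From the ranking to an antimagic labeling.

  odd-regular⇒antimagic : ∀ K → 0 < K → Regular G (suc (K + K)) → Antimagic G
  odd-regular⇒antimagic K 0<K regular = labeling , λ {u} {v} u≢v sums≡ →
    proj₂ (proj₂ ordered) u≢v (trans (sym (vsum-≡ u)) (trans sums≡ (vsum-≡ v)))
    where
    module R = Ranking ranking
    open Orientation R.ρ R.step

    degrees : ∀ v → ∑ (λ e → δ v (tp e) + δ v (sp e)) (edges G) ≡ suc (K + K)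
    degrees v = begin
      ∑ (λ e → δ v (tp e) + δ v (sp e)) (edges G)  ≡⟨ ∑-cong (λ e → trans (incidence-≡ v e) (sym (*-identityʳ _))) (edges G) ⟩
      ∑ (λ e → incidence v e * 1) (edges G)        ≡⟨ sym (∑-incident v (λ _ → 1)) ⟩
      ∑ (λ _ → 1) (incidentEdges G v)              ≡⟨ ∑-1 (incidentEdges G v) ⟩
      degree G v                                   ≡⟨ regular v ⟩
      suc (K + K)                                  ∎
      where open ≡-Reasoning

    grounded : ∀ v → (∃ λ e → e ∈ edges G × Layers.UpAt tp sp (edges G) R.ρ v e) ⊎ (∀ u → R.ρ u ≡ R.ρ v → u ≡ v)
    grounded v with R.grounded v
    ... | inj₁ (_ , u~v , eq) = inj₁ (edgeTo u~v eq)
    ... | inj₂ alone          = inj₂ alone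

    open Levels tp sp (edges G) R.ρ K 0<K rank degrees simple grounded using (vsum; ordering)

    ordered : ∃ λ order → (∀ g → ∑ g order ≡ ∑ g (edges G)) × (∀ {u v} → u ≢ v → vsum u order ≢ vsum v order)
    ordered = ordering R.ρ<height

    open Labelling (proj₁ ordered) (proj₁ (proj₂ ordered))

    vsum-≡ : ∀ v → vertexSum G labeling v ≡ vsum v (proj₁ ordered)
    vsum-≡ v = trans (vertexSum-≡ v)
      (weighted-cong 1 {proj₁ ordered} (All.tabulate λ {e} _ → sym (incidence-≡ v e)))

mainTheorem1 : ∀ (k : ℕ) → parity k ≡ 1ℙ → k ≥ 3 →
    ∀ (n : ℕ) (G : Graph n) → Regular G k → Antimagic G
mainTheorem1 k odd k≥3 n G regular with odd⇒1+double k odd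
... | zero  , refl = contradiction k≥3 λ { (s≤s ()) }
... | suc K , refl = odd-regular⇒antimagic G (suc K) z<s regular
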